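{- There is an absolute constant $c>0$ such that the following holds. Let $V$ be a dataset of $n$ elements of a metric space $(U,d)$, let $\mathcal{C}=\{C_1,\dots,C_k\}$ be a $k$-clustering of $V$, and let $0<\varepsilon,\delta<1$. Let $\widehat{s}(e)$, $e\in V$, be the estimates computed by the algorithm SILH-PPS-ALL (defined in the context) run on $\mathcal{C}$ with parameters $\varepsilon,\delta$ and sample size $t=\lceil c\,\varepsilon^{ -2}\ln(5nk/\delta)\rceil$, and let $\widehat{s}_2(\mathcal{C})=\frac1n\sum_{e\in V}\widehat{s}(e)$. Then, with probability at least $1-\delta$, $$|\widehat{s}_2(\mathcal{C})-s(\mathcal{C})|\le\frac{4\varepsilon}{1-\varepsilon}.$$
   Context: A dataset is a finite set $V=\{e_1,\dots,e_n\}\subseteq U$ of $n$ distinct elements of a metric space $(U,d)$. A $k$-clustering $\mathcal{C}=\{C_1,\dots,C_k\}$ of $V$ is a partition of $V$ into $k$ disjoint nonempty subsets (clusters); here $k\ge 2$. For $e\in V$ belonging to cluster $C$ with $|C|\ge 2$, let $a(e)=\frac{1}{|C|-1}\sum_{e'\in C}d(e,e')$ and $b(e)=\min_{C_j\in\mathcal{C},\,C_j\ne C}\frac{1}{|C_j|}\sum_{e'\in C_j}d(e,e')$. The silhouette of $e$ is $s(e)=\frac{b(e)-a(e)}{\max\{a(e),b(e)\}}$; if $C=\{e\}$, then $s(e)=0$. The silhouette of the clustering is $s(\mathcal{C})=\frac1n\sum_{i=1}^n s(e_i)$. Write $W_{C_j}(e)=\sum_{e'\in C_j}d(e,e')$.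 Algorithm SILH-PPS-ALL (input: $\mathcal{C}$, $\delta$, sample size $t$). Phase 1 (PPS sampling), independently for each cluster $C_j$: if $|C_j|\le t$, set $F_{C_j}=C_j$ and $p_e=1$ for all $e\in C_j$. Otherwise: (i) form $F^0_{C_j}\subseteq C_j$ by including each element of $C_j$ independently with probability $\frac{2}{|C_j|}\ln(5k/\delta)$; (ii) for each $e\in C_j$ set $\gamma_e=\max\left\{\frac1{|C_j|},\ \max_{\bar e\in F^0_{C_j}}\frac{d(e,\bar e)}{W_{C_j}(\bar e)}\right\}$ (the inner maximum is omitted if $F^0_{C_j}=\emptyset$) and $p_e=\min\{1,t\gamma_e\}$; (iii) given these probabilities, form $F_{C_j}\subseteq C_j$ by including each $e\in C_j$ independently with probability $p_e$. Phase 2 (estimation): for each $e\in V$ and each $j$ set $\widehat W_{C_j}(e)=\sum_{e'\in F_{C_j}}d(e,e')/p_{e'}$. For $e$ in cluster $C$ with $|C|\ge2$ set $\widehat a(e)=\widehat W_C(e)/(|C|-1)$, $\widehat b(e)=\min_{C_j\ne C}\widehat W_{C_j}(e)/|C_j|$, and $\widehat s(e)=\frac{\widehat b(e)-\widehat a(e)}{\max\{\widehat a(e),\widehat b(e)\}}$; $\widehat s(e)=0$ if $C=\{e\}$ or if the denominator is $0$. -}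

module Defs where

open import Algebra.Bundles using (CommutativeRing)
open import Algebra.Core using (Op₁; Op₂)
open import Algebra.Structures using (IsCommutativeRing)
import Algebra.Construct.NaturalChoice.Max as NaturalMax
import Algebra.Construct.NaturalChoice.Min as NaturalMin
import Algebra.Properties.CommutativeMonoid.Sum as MonoidSum
import Algebra.Properties.Ring as RingProperties
import Algebra.Properties.Semiring.Exp as SemiringExp
import Algebra.Properties.Semiring.Mult as SemiringMult
open import Data.Bool.Base using (Bool; true; false; if_then_else_)
open import Data.Fin.Base using (Fin; zero; suc; toℕ; punchIn)
import Data.Fin.Properties as Fin
open import Data.Fin.Subset using (Subset; ∣_∣)
open import Data.List.Base using (List; []; _∷_; map; concatMap; filter; foldr)
open import Data.Nat.Base as ℕ using (ℕ; zero; suc; s≤s; z≤n; _!)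
import Data.Nat.Properties as ℕ
open import Data.Product.Base using (∃; _×_; _,_; proj₁; proj₂)
open import Data.Sum.Base using (_⊎_; inj₁; inj₂)
open import Data.Vec.Base using (Vec; []; _∷_; lookup; tabulate)
import Data.Vec.Functional as Vector
open import Function.Base using (_∘_; const)
open import Function.Definitions using (Injective; Surjective)
open import Function.Metric.Structures using (IsGeneralMetric)
open import Level using (Level) renaming (suc to lsuc; _⊔_ to _⊔ˡ_)
open import Relation.Binary.Bundles using (DecTotalOrder)
open import Relation.Binary.Core using (Rel)
open import Relation.Binary.PropositionalEquality.Core using (_≡_)
open import Relation.Binary.Structures using (IsDecTotalOrder)
open import Relation.Nullary.Decidable.Core using (does; yes; no)
open import Relation.Nullary.Negation.Core using (¬_; contradiction)
open import Relation.Unary using (Pred; Decidable)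

-- The real numbers, axiomatised as a complete ordered field with the
-- usual classical (decidable) order.  These axioms determine ℝ up to
-- isomorphism; exhibiting an instance requires excluded middle.
record CompleteOrderedField (c ℓ : Level) : Set (lsuc (c ⊔ˡ ℓ)) where
  infix  4 _≈_ _≤_ _<_
  infixl 6 _+_
  infixl 7 _*_
  infix  8 -_
  field
    ℝ                 : Set c
    _≈_               : Rel ℝ ℓ
    _≤_               : Rel ℝ ℓ
    _+_               : Op₂ ℝ
    _*_               : Op₂ ℝ
    -_                : Op₁ ℝ
    0#                : ℝ
    1#                : ℝ
    isCommutativeRing : IsCommutativeRing _≈_ _+_ _*_ -_ 0# 1#
    isDecTotalOrder   : IsDecTotalOrder _≈_ _≤_

  _<_ : Rel ℝ ℓ
  x < y = x ≤ y × ¬ (x ≈ y)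

  IsUpperBound : Pred ℝ ℓ → Pred ℝ (c ⊔ˡ ℓ)
  IsUpperBound P u = ∀ x → P x → x ≤ u

  -- Least upper bound in the ε-form: no smaller number is an upper bound.
  IsSupremum : Pred ℝ ℓ → Pred ℝ (c ⊔ˡ ℓ)
  IsSupremum P s = IsUpperBound P s × (∀ x → x < s → ∃ λ y → P y × x < y)

  field
    0≉1       : ¬ (0# ≈ 1#)
    inverse   : ∀ x → ¬ (x ≈ 0#) → ∃ λ y → x * y ≈ 1#
    +-monoˡ-≤ : ∀ z {x y} → x ≤ y → x + z ≤ y + z
    *-nonNeg  : ∀ {x y} → 0# ≤ x → 0# ≤ y → 0# ≤ x * y
    complete  : ∀ P → ∃ P → ∃ (IsUpperBound P) → ∃ (IsSupremum P)

module RealArithmetic {c ℓ : Level} (R : CompleteOrderedField c ℓ) where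

  open CompleteOrderedField R public
  open IsDecTotalOrder isDecTotalOrder public
    using (_≟_; _≤?_; total; antisym)
    renaming (refl to ≤-refl; trans to ≤-trans; reflexive to ≤-reflexive)

  commutativeRing : CommutativeRing c ℓ
  commutativeRing = record { isCommutativeRing = isCommutativeRing }

  decTotalOrder : DecTotalOrder c ℓ ℓ
  decTotalOrder = record { isDecTotalOrder = isDecTotalOrder }

  open CommutativeRing commutativeRing public
    using ( _-_; refl; sym; trans; +-cong; *-cong; *-congʳ; *-congˡ; +-identityˡ
          ; +-identityʳ; *-identityˡ; *-identityʳ; +-comm; zeroˡ; -‿inverseʳ
          ; +-assoc; -‿inverseˡ; +-congˡ; +-congʳ )
  open DecTotalOrder decTotalOrder using (totalOrder)
  open NaturalMin totalOrder public using (_⊓_)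
  open NaturalMax totalOrder public using (_⊔_)
  open MonoidSum (CommutativeRing.+-commutativeMonoid commutativeRing) public
    using (sum; sum-cong-≋; sum-replicate-zero)
  open SemiringExp (CommutativeRing.semiring commutativeRing) public using (_^_)
  open SemiringMult (CommutativeRing.semiring commutativeRing) using ()
    renaming (_×_ to _×ᵣ_)
  open RingProperties (CommutativeRing.ring commutativeRing)
    using (-‿distribˡ-*; -‿involutive)

  infix  8 _⁻¹
  infixl 7 _/_

  -- Total inversion and division, with x / 0 ≈ 0.
  _⁻¹ : ℝ → ℝ
  x ⁻¹ with x ≟ 0#
  ... | yes _   = 0#
  ... | no  x≉0 = proj₁ (inverse x x≉0)

  _/_ : ℝ → ℝ → ℝ
  x / y = x * y ⁻¹

  ∣_∣ᵣ : ℝ → ℝ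
  ∣ x ∣ᵣ = x ⊔ (- x)

  fromℕ : ℕ → ℝ
  fromℕ n = n ×ᵣ 1#

  ⁻¹-inverseʳ : ∀ {x} → ¬ (x ≈ 0#) → x * x ⁻¹ ≈ 1#
  ⁻¹-inverseʳ {x} x≉0 with x ≟ 0#
  ... | yes x≈0 = contradiction x≈0 x≉0
  ... | no  x≉0′ = proj₂ (inverse x x≉0′)

  x≈1⇒x⁻¹≈1 : ∀ {x} → x ≈ 1# → x ⁻¹ ≈ 1#
  x≈1⇒x⁻¹≈1 {x} x≈1 =
    trans (sym (*-identityˡ _))
      (trans (*-congʳ (sym x≈1))
        (⁻¹-inverseʳ (λ x≈0 → 0≉1 (trans (sym x≈0) x≈1))))

  +-monoʳ-≤ : ∀ z {x y} → x ≤ y → z + x ≤ z + y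
  +-monoʳ-≤ z x≤y = ≤-trans (≤-reflexive (+-comm _ _))
    (≤-trans (+-monoˡ-≤ z x≤y) (≤-reflexive (+-comm _ _)))

  0≤1 : 0# ≤ 1#
  0≤1 with total 0# 1#
  ... | inj₁ 0≤1 = 0≤1
  ... | inj₂ 1≤0 = ≤-trans (*-nonNeg 0≤-1 0≤-1) (≤-reflexive -1*-1≈1)
    where
    0≤-1 : 0# ≤ - 1#
    0≤-1 = ≤-trans (≤-reflexive (sym (-‿inverseʳ 1#)))
      (≤-trans (+-monoˡ-≤ (- 1#) 1≤0) (≤-reflexive (+-identityˡ _)))
    -1*-1≈1 : - 1# * - 1# ≈ 1#
    -1*-1≈1 = trans (sym (-‿distribˡ-* 1# (- 1#)))
      (trans (CommutativeRing.-‿cong commutativeRing (*-identityˡ _))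
        (-‿involutive 1#))

  x-1+1≈x : ∀ x → x - 1# + 1# ≈ x
  x-1+1≈x x = trans (+-assoc _ _ _)
    (trans (+-congˡ (-‿inverseˡ 1#)) (+-identityʳ x))

  x-1<x : ∀ x → x - 1# < x
  x-1<x x = x-1≤x , x-1≉x
    where
    x-1≤x : x - 1# ≤ x
    x-1≤x = ≤-trans (≤-reflexive (sym (+-identityʳ _)))
      (≤-trans (+-monoʳ-≤ (x - 1#) 0≤1) (≤-reflexive (x-1+1≈x x)))
    x-1≉x : ¬ (x - 1# ≈ x)
    x-1≉x x-1≈x = 0≉1 (trans (sym (-‿inverseˡ x)) (trans
      (+-congˡ (sym (trans (+-congʳ (sym x-1≈x)) (x-1+1≈x x))))
      (trans (sym (+-assoc _ _ _)) (trans (+-congʳ (-‿inverseˡ x)) (+-identityˡ 1#)))))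

  -- ℕ is unbounded by completeness; a second supremum, of a subset of
  -- {0 , 1}, decides whether x is below some natural number.
  archimedean : ∀ x → ∃ λ n → x ≤ fromℕ n
  archimedean x with complete P (0# , inj₁ refl) (1# , P-bounded)
    where
    P : Pred ℝ ℓ
    P y = y ≈ 0# ⊎ (y ≈ 1# × ∃ λ n → x ≤ fromℕ n)
    P-bounded : IsUpperBound P 1#
    P-bounded y (inj₁ y≈0)       = ≤-trans (≤-reflexive y≈0) 0≤1
    P-bounded y (inj₂ (y≈1 , _)) = ≤-reflexive y≈1
  ... | s , s-upper , s-least with s ≤? 0#
  ...   | no s≰0 with total 0# s
  ...     | inj₂ s≤0 = contradiction s≤0 s≰0
  ...     | inj₁ 0≤s with s-least 0# (0≤s , λ 0≈s → s≰0 (≤-reflexive (sym 0≈s)))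
  ...       | y , inj₁ y≈0 , _ , 0≉y = contradiction (sym y≈0) 0≉y
  ...       | y , inj₂ (_ , n , x≤n) , _ = n , x≤n
  archimedean x | s , s-upper , s-least | yes s≤0 = contradiction ℕ-exceeds unbounded
    where
    unbounded : ¬ (∃ λ n → x ≤ fromℕ n)
    unbounded e = 0≉1 (antisym 0≤1 (≤-trans (s-upper 1# (inj₂ (refl , e))) s≤0))
    IsNat : Pred ℝ ℓ
    IsNat y = ∃ λ n → y ≈ fromℕ n
    below : IsUpperBound IsNat x
    below y (n , y≈n) with total y x
    ... | inj₁ y≤x = y≤x
    ... | inj₂ x≤y = contradiction (n , ≤-trans x≤y (≤-reflexive y≈n)) unbounded
    ℕ-exceeds : ∃ λ n → x ≤ fromℕ n
    ℕ-exceeds with complete IsNat (0# , 0 , refl) (x , below)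
    ... | σ , σ-upper , σ-least with σ-least (σ - 1#) (x-1<x σ)
    ...   | y , (n , y≈n) , σ-1≤y , σ-1≉y = contradiction (antisym σ-1≤y y≤σ-1) σ-1≉y
      where
      1+n≤σ : 1# + fromℕ n ≤ σ
      1+n≤σ = σ-upper _ (suc n , refl)
      y≤σ-1 : y ≤ σ - 1#
      y≤σ-1 = ≤-trans
        (≤-reflexive (trans y≈n (sym (trans (+-congʳ (+-comm 1# (fromℕ n)))
          (trans (+-assoc _ _ _) (trans (+-congˡ (-‿inverseʳ 1#)) (+-identityʳ _)))))))
        (+-monoˡ-≤ (- 1#) 1+n≤σ)

  -- The ceiling of x, truncated to 0 for negative x, given a bound on it.
  boundedCeiling : ℕ → ℝ → ℕ
  boundedCeiling zero    x = 0
  boundedCeiling (suc b) x =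
    if does (x ≤? 0#) then 0 else suc (boundedCeiling b (x - 1#))

  ⌈_⌉ : ℝ → ℕ
  ⌈ x ⌉ = boundedCeiling (proj₁ (archimedean x)) x

  expSum : ℕ → ℝ → ℝ
  expSum n x = sum {n} (λ i → x ^ toℕ i / fromℕ (toℕ i !))

  -- For x ≥ 0 the partial sums increase to eˣ, so this says eˣ ≤ y.
  Exp≤ : ℝ → Pred ℝ ℓ
  Exp≤ y x = 0# ≤ x × ∀ n → expSum n x ≤ y

  private
    0^0/0!≈1 : ∀ x → x ^ 0 / fromℕ (0 !) ≈ 1#
    0^0/0!≈1 x = trans (*-identityˡ _) (x≈1⇒x⁻¹≈1 (+-identityʳ 1#))

  Exp≤-inhabited : ∀ {y} → 1# ≤ y → ∃ (Exp≤ y)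
  Exp≤-inhabited {y} 1≤y = 0# , ≤-refl , λ n → ≤-trans (expSum0≤1 n) 1≤y
    where
    0^1+i/≈0 : ∀ n (i : Fin n) →
      0# ^ suc (toℕ i) / fromℕ (suc (toℕ i) !) ≈ 0#
    0^1+i/≈0 n i = trans (*-congʳ (zeroˡ _)) (zeroˡ _)
    expSum0≤1 : ∀ n → expSum n 0# ≤ 1#
    expSum0≤1 zero    = 0≤1
    expSum0≤1 (suc n) = ≤-reflexive (trans
      (+-cong (0^0/0!≈1 0#)
        (trans (sum-cong-≋ (0^1+i/≈0 n)) (sum-replicate-zero n)))
      (+-identityʳ 1#))

  Exp≤-bounded : ∀ y → IsUpperBound (Exp≤ y) y
  Exp≤-bounded y x (_ , sums≤y) = ≤-trans
    (≤-trans (≤-reflexive (sym (+-identityˡ x)))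
      (≤-trans (+-monoˡ-≤ x 0≤1) (≤-reflexive (sym expSum2≈1+x))))
    (sums≤y 2)
    where
    expSum2≈1+x : expSum 2 x ≈ 1# + x
    expSum2≈1+x = +-cong (0^0/0!≈1 x)
      (trans (+-identityʳ _)
        (trans (*-cong (*-identityʳ x) (x≈1⇒x⁻¹≈1 (+-identityʳ 1#)))
          (*-identityʳ x)))

  ln≥1 : ∀ y → 1# ≤ y → ℝ
  ln≥1 y 1≤y = proj₁ (complete (Exp≤ y) (Exp≤-inhabited 1≤y) (y , Exp≤-bounded y))

  -- ln y = sup {x ≥ 0 | eˣ ≤ y} for y ≥ 1, ln y = - ln (1/y) for 0 < y < 1,
  -- and ln y = 0 by convention for y ≤ 0.
  ln : ℝ → ℝ
  ln y with 1# ≤? y | 1# ≤? y ⁻¹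
  ... | yes 1≤y | _         = ln≥1 y 1≤y
  ... | no  _   | yes 1≤y⁻¹ = - ln≥1 (y ⁻¹) 1≤y⁻¹
  ... | no  _   | no  _     = 0#

  sumOver : ∀ {n} → Subset n → (Fin n → ℝ) → ℝ
  sumOver S f = sum (λ i → if lookup S i then f i else 0#)

  maxOver : ∀ {n} → ℝ → Subset n → (Fin n → ℝ) → ℝ
  maxOver x S f = Vector.foldr _⊔_ x (λ i → if lookup S i then f i else x)

  minimum : ∀ {n} → (Fin (suc n) → ℝ) → ℝ
  minimum {zero}  f = f zero
  minimum {suc n} f = f zero ⊓ minimum (f ∘ suc)

  minOther : ∀ {k} → 2 ℕ.≤ k → Fin k → (Fin k → ℝ) → ℝ
  minOther (s≤s (s≤s z≤n)) i f = minimum (f ∘ punchIn i)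

  average : ∀ {n} → (Fin n → ℝ) → ℝ
  average {n} f = (1# / fromℕ n) * sum f

-- Finitely supported random experiments, as lists of weighted outcomes.
module Probability {c ℓ : Level} (R : CompleteOrderedField c ℓ) where

  open RealArithmetic R

  private
    variable
      a b p : Level
      A : Set a
      B : Set b

  Dist : Set a → Set (c ⊔ˡ a)
  Dist A = List (ℝ × A)

  return : A → Dist A
  return x = (1# , x) ∷ []

  infixl 1 _>>=_
  _>>=_ : Dist A → (A → Dist B) → Dist B
  μ >>= κ = concatMap (λ (w , x) → map (λ (v , y) → (w * v , y)) (κ x)) μ

  bernoulli : ℝ → Dist Bool
  bernoulli q = (q , true) ∷ (1# - q , false) ∷ []

  independently : ∀ {n} → (Fin n → Dist A) → Dist (Vec A n)
  independently {n = zero}  μ = return []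
  independently {n = suc n} μ = do
    x  ← μ zero
    xs ← independently (μ ∘ suc)
    return (x ∷ xs)

  randomSubset : ∀ {n} → Subset n → (Fin n → ℝ) → Dist (Subset n)
  randomSubset S q =
    independently (λ e → if lookup S e then bernoulli (q e) else return false)

  Pr : Dist A → {P : Pred A p} → Decidable P → ℝ
  Pr μ P? = foldr (λ (w , _) → w +_) 0# (filter (P? ∘ proj₂) μ)

-- A partition of n elements into k nonempty clusters, given by the map
-- sending each element to the index of its cluster.
record Clustering (n k : ℕ) : Set where
  field
    2≤k      : 2 ℕ.≤ k
    cluster  : Fin n → Fin k
    nonempty : Surjective _≡_ _≡_ cluster

  members : Fin k → Subset n
  members j = tabulate (λ e → does (cluster e Fin.≟ j))

  size : Fin k → ℕ
  size j = ∣ members j ∣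

module _ {c ℓ : Level} (R : CompleteOrderedField c ℓ) where

  open CompleteOrderedField R using (ℝ; _≤_; _+_; 0#) renaming (_≈_ to _≈ᵣ_)

  record MetricSpace (u ℓᵤ : Level) : Set (c ⊔ˡ ℓ ⊔ˡ lsuc (u ⊔ˡ ℓᵤ)) where
    infix 4 _≈_
    field
      U               : Set u
      _≈_             : Rel U ℓᵤ
      d               : U → U → ℝ
      isGeneralMetric : IsGeneralMetric _≈_ _≈ᵣ_ _≤_ 0# _+_ d

record Dataset {c ℓ u ℓᵤ : Level} {R : CompleteOrderedField c ℓ}
               (M : MetricSpace R u ℓᵤ) (n : ℕ) : Set (u ⊔ˡ ℓᵤ) where
  open MetricSpace M
  field
    element  : Fin n → U
    distinct : Injective _≡_ _≈_ element

-- Elements of the dataset are referred to by their indices in Fin n,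
-- clusters by their indices in Fin k.
module Silhouette
  {c ℓ u ℓᵤ : Level} {R : CompleteOrderedField c ℓ} {M : MetricSpace R u ℓᵤ}
  {n k : ℕ} (V : Dataset M n) (𝒞 : Clustering n k)
  where

  open RealArithmetic R
  open Probability R
  open MetricSpace M using (d)
  open Dataset V
  open Clustering 𝒞

  dist : Fin n → Fin n → ℝ
  dist e e′ = d (element e) (element e′)

  -- The silhouette computed from a table w of (exact or estimated) sums
  -- of distances, w j e standing for the sum from e to cluster j.
  module From (w : Fin k → Fin n → ℝ) where

    a : Fin n → ℝ
    a e = w (cluster e) e / (fromℕ (size (cluster e)) - 1#)

    b : Fin n → ℝ
    b e = minOther 2≤k (cluster e) (λ j → w j e / fromℕ (size j))

    -- Division gives 0 when the denominator is 0.  This is the convention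
    -- of the estimator; it is never used for the exact silhouette, where
    -- a e > 0 because the elements are distinct.
    s : Fin n → ℝ
    s e = if does (size (cluster e) ℕ.≟ 1) then 0#
          else (b e - a e) / (a e ⊔ b e)

  W : Fin k → Fin n → ℝ
  W j e = sumOver (members j) (dist e)

  silhouette : ℝ
  silhouette = average (From.s W)

  module SilhPPSAll (δ : ℝ) (t : ℕ) where

    γ : Fin k → Subset n → Fin n → ℝ
    γ j F⁰ e = maxOver (1# / fromℕ (size j)) F⁰ (λ ē → dist e ē / W j ē)

    Sample : Set c
    Sample = Subset n × (Fin n → ℝ)

    -- The cap at 1 in the first sampling step is inactive as soon as
    -- t ≥ 2 ln(5k/δ); it makes the experiment meaningful for every t.
    samplePPS : Fin k → Dist Sample
    samplePPS j =
      if does (size j ℕ.≤? t) then return (members j , const 1#) else do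
        let p⁰ = 1# ⊓ (fromℕ 2 / fromℕ (size j) * ln (fromℕ (5 ℕ.* k) / δ))
        F⁰ ← randomSubset (members j) (const p⁰)
        let p = λ e → 1# ⊓ (fromℕ t * γ j F⁰ e)
        F ← randomSubset (members j) p
        return (F , p)

    Ŵ : Vec Sample k → Fin k → Fin n → ℝ
    Ŵ samples j e = let (F , p) = lookup samples j in
      sumOver F (λ e′ → dist e e′ / p e′)

    estimates : Dist (Fin n → ℝ)
    estimates = do
      samples ← independently samplePPS
      return (From.s (Ŵ samples))

{-# OPTIONS --safe #-}

-- If every estimated sum Ŵ_j(e) is within a factor 1 ± ε of W_j(e), then so
-- are the estimates of a, b and max(a, b), and |ŝ(e) - s(e)| ≤ 3ε / (1 - ε).
--
-- For one cluster C with |C| > t, call ē ∈ C a good pivot if W(ē) is at most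
-- twice the average of W over C.  At least half of C is good, so F⁰ misses all
-- good pivots with probability at most δ/(5k).  A good pivot has W(ē) ≤ 4 W(v)
-- for every v, whence d(v, e) ≤ 9 γ_e W(v) for all e ∈ C: each summand of
-- Ŵ(v) that is really random is at most 9 W(v) / t, and a Chernoff bound makes
-- Ŵ(v) miss (1 ± ε) W(v) with probability at most 2 exp(- ε² t / 72).  With
-- t ≥ 72 ε⁻² ln(5nk/δ) this is 2δ/(5nk), and a union bound over the elements v
-- and over the clusters leaves a total failure probability of 3δ/5.

module Submission where

open import Algebra.Bundles using (CommutativeRing; RawRing)
import Algebra.Construct.NaturalChoice.Max as NaturalMax
import Algebra.Construct.NaturalChoice.Min as NaturalMin
import Algebra.Properties.Monoid.Sum as MonoidSum
import Algebra.Properties.Ring as RingProperties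
import Algebra.Properties.Semiring.Mult as SemiringMult
import Algebra.Properties.Semiring.Sum as SemiringSum
import Algebra.Solver.Ring as RingSolver
open import Algebra.Solver.Ring.AlmostCommutativeRing
  using (fromCommutativeRing; _-Raw-AlmostCommutative⟶_; Induced-equivalence)
import Algebra.Solver.Ring.NaturalCoefficients.Default as SemiringSolver
open import Data.Bool.Base using (Bool; true; false; if_then_else_)
import Data.Bool.Properties as Bool
open import Data.Fin.Base using (Fin; zero; suc; toℕ; fromℕ<; punchIn)
import Data.Fin.Properties as Fin
open import Data.Fin.Subset using (Subset; ∣_∣)
open import Data.List.Base using ([]; _∷_; _++_; map; foldr)
open import Data.List.Relation.Unary.All as All using (All; []; _∷_)
import Data.List.Relation.Unary.All.Properties as All
open import Data.Maybe.Base using (just; nothing)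
open import Data.Nat.Base as ℕ using (ℕ; zero; suc; _!)
import Data.Nat.Properties as ℕ
open import Data.Product.Base using (∃; _×_; _,_; proj₁; proj₂)
open import Data.Sum.Base using (_⊎_; inj₁; inj₂)
open import Data.Unit.Base using (⊤; tt)
open import Data.Vec.Base using (Vec; []; _∷_; lookup)
open import Data.Vec.Properties using (lookup∘tabulate)
open import Function.Base using (_∘_; const; case_of_)
open import Function.Metric.Structures using (module IsGeneralMetric)
open import Level using (Level)
open import Relation.Binary.Bundles using (DecTotalOrder)
open import Relation.Binary.Definitions using (WeaklyDecidable)
open import Relation.Binary.PropositionalEquality.Core as ≡ using (_≡_)
import Relation.Binary.Reasoning.PartialOrder as PartialOrderReasoning
open import Relation.Nullary.Decidable using (Dec; does; yes; no; ¬?; _×-dec_; dec-true)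
open import Relation.Nullary.Negation.Core using (¬_; contradiction)
open import Relation.Unary using (Pred; Decidable)
open import Defs

-- What shapes the proof is that only partial sums of the exponential series are at hand, with `ln`
-- a supremum over them. All exponential estimates therefore take the form `m eˣ ≤ 1`, with `m` a
-- product of polynomial factors; such estimates multiply, and `eˣ` is traded for `y` as soon as
-- `ln y ≤ x`. For the same reason the Chernoff argument does not use the moments of `eᵃ`: every
-- element carries a polynomial weight of expectation exactly 1, and a second polynomial factor
-- links this weight to the exponential.
--
-- The constants: in 9 = 5 + 4, the term 1/|C| of γ pays 5 for d(v, ē) and the pivot term pays 4 for
-- d(ē, e). Tilting exponents are kept below ε/4, which puts 36 = 4 · 9 into the tilting rate;
-- second-order terms cost half of the gain in the exponent, which gives 72 = 2 · 36.
--
-- Probabilities are bounded as `y * probability ≤ constant` with `y` = 5k/δ or 5nk/δ, so that `y`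
-- can meet `ln y` directly.

-- Ordered-field arithmetic, with a ring solver over integer coefficients.

module OrderedField {c ℓ} (R : CompleteOrderedField c ℓ) where

  open RealArithmetic R public
  open CommutativeRing commutativeRing public
    using ( *-comm; *-assoc; zeroʳ; distribˡ; distribʳ; -‿cong; reflexive; ring; semiring
          ; commutativeSemiring; *-monoid )
  open RingProperties ring public using (-0#≈0#; -‿+-comm; -‿distribˡ-*; -‿involutive)
  open SemiringMult semiring using (×1-homo-*; ×-homo-+)
  open SemiringSum semiring public
    using (∑-distrib-+; *-distribˡ-sum)
  open DecTotalOrder decTotalOrder using (totalOrder; poset)
  open NaturalMin totalOrder public using (x⊓y≤x; x⊓y≤y; ⊓-glb; ⊓-sel)
  open NaturalMax totalOrder public using (x≤x⊔y; x≤y⊔x; ⊔-lub; ⊔-sel)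
  module ≤-Reasoning = PartialOrderReasoning poset

  fromℕ-+ : ∀ m n → fromℕ (m ℕ.+ n) ≈ fromℕ m + fromℕ n
  fromℕ-+ = ×-homo-+ 1#

  fromℕ-* : ∀ m n → fromℕ (m ℕ.* n) ≈ fromℕ m * fromℕ n
  fromℕ-* = ×1-homo-*

  -- The integer (m , n), standing for m - n, is interpreted so that the
  -- literals 0, 1 and n ≥ 2 mean 0#, 1# and fromℕ n on the nose.
  private
    ⟦_⟧ℕ : ℕ → ℝ
    ⟦ 1 ⟧ℕ = 1#
    ⟦ n ⟧ℕ = fromℕ n

    ⟦_⟧ℤ : ℕ × ℕ → ℝ
    ⟦ m , zero ⟧ℤ = ⟦ m ⟧ℕ
    ⟦ m , n    ⟧ℤ = fromℕ m - fromℕ n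

    ⟦⟧ℕ≈fromℕ : ∀ n → ⟦ n ⟧ℕ ≈ fromℕ n
    ⟦⟧ℕ≈fromℕ 0             = refl
    ⟦⟧ℕ≈fromℕ 1             = sym (+-identityʳ 1#)
    ⟦⟧ℕ≈fromℕ (suc (suc n)) = refl

    ⟦⟧ℤ≈difference : ∀ m n → ⟦ m , n ⟧ℤ ≈ fromℕ m - fromℕ n
    ⟦⟧ℤ≈difference m (suc n) = refl
    ⟦⟧ℤ≈difference m zero    = trans (⟦⟧ℕ≈fromℕ m)
      (trans (sym (+-identityʳ _)) (+-congˡ (sym -0#≈0#)))

    -- The solver compares normal forms syntactically, so (1 , 1) must become (0 , 0).
    cancel : ℕ × ℕ → ℕ × ℕ
    cancel (m , n) = m ℕ.∸ n , n ℕ.∸ m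

    differences : RawRing _ _
    differences = record
      { Carrier = ℕ × ℕ
      ; _≈_ = _≡_
      ; _+_ = λ (m , n) (m′ , n′) → cancel (m ℕ.+ m′ , n ℕ.+ n′)
      ; _*_ = λ (m , n) (m′ , n′) → cancel (m ℕ.* m′ ℕ.+ n ℕ.* n′ , m ℕ.* n′ ℕ.+ n ℕ.* m′)
      ; -_ = λ (m , n) → n , m
      ; 0# = 0 , 0
      ; 1# = 1 , 0
      }

    open SemiringSolver commutativeSemiring using ()
      renaming (solve to solveₛ; _:+_ to _⊕_; _:*_ to _⊛_; _:=_ to _⊜_)

    [a-b]*[c-d] : ∀ a b c d → (a - b) * (c - d) ≈ (a * c + b * d) - (a * d + b * c)
    [a-b]*[c-d] a b c d = begin-equality
      (a - b) * (c - d)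
        ≈⟨ solveₛ 4 (λ a b c d → (a ⊕ b) ⊛ (c ⊕ d) ⊜ (a ⊛ c ⊕ b ⊛ d) ⊕ (a ⊛ d ⊕ b ⊛ c)) refl a (- b) c (- d) ⟩
      (a * c + - b * - d) + (a * - d + - b * c)
        ≈⟨ +-cong (+-congˡ -b*-d≈b*d) (trans (+-cong a*-d≈-ad (sym (-‿distribˡ-* b c))) (-‿+-comm _ _)) ⟩
      (a * c + b * d) - (a * d + b * c) ∎
      where
      open ≤-Reasoning
      a*-d≈-ad : a * - d ≈ - (a * d)
      a*-d≈-ad = trans (*-comm _ _) (trans (sym (-‿distribˡ-* d a)) (-‿cong (*-comm d a)))
      -b*-d≈b*d : - b * - d ≈ b * d
      -b*-d≈b*d = trans (sym (-‿distribˡ-* b (- d))) (trans (-‿cong (trans (*-comm _ _)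
        (trans (sym (-‿distribˡ-* d b)) (-‿cong (*-comm d b))))) (-‿involutive _))

    [a+b]-[c+d] : ∀ a b c d → (a + b) - (c + d) ≈ (a - c) + (b - d)
    [a+b]-[c+d] a b c d = trans (+-congˡ (sym (-‿+-comm c d)))
      (solveₛ 4 (λ a b c d → (a ⊕ b) ⊕ (c ⊕ d) ⊜ (a ⊕ c) ⊕ (b ⊕ d)) refl a b (- c) (- d))

    equal-differences : ∀ a b c d → a + d ≈ c + b → a - b ≈ c - d
    equal-differences a b c d a+d≈c+b = begin-equality
      a - b               ≈⟨ +-identityʳ _ ⟨
      (a - b) + 0#        ≈⟨ +-congˡ (-‿inverseʳ d) ⟨
      (a - b) + (d - d)   ≈⟨ solveₛ 4 (λ a b d e → (a ⊕ b) ⊕ (d ⊕ e) ⊜ (a ⊕ d) ⊕ (b ⊕ e)) refl a (- b) d (- d) ⟩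
      (a + d) + (- b - d) ≈⟨ +-congʳ a+d≈c+b ⟩
      (c + b) + (- b - d) ≈⟨ solveₛ 4 (λ c b b′ e → (c ⊕ b) ⊕ (b′ ⊕ e) ⊜ (c ⊕ e) ⊕ (b ⊕ b′)) refl c b (- b) (- d) ⟩
      (c - d) + (b - b)   ≈⟨ +-congˡ (-‿inverseʳ b) ⟩
      (c - d) + 0#        ≈⟨ +-identityʳ _ ⟩
      c - d               ∎
      where open ≤-Reasoning

    ⟦cancel⟧≈difference : ∀ m n → ⟦ cancel (m , n) ⟧ℤ ≈ fromℕ m - fromℕ n
    ⟦cancel⟧≈difference m n = trans (⟦⟧ℤ≈difference (m ℕ.∸ n) (n ℕ.∸ m))
      (equal-differences _ _ _ _ (trans (sym (fromℕ-+ (m ℕ.∸ n) n))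
        (trans (reflexive (≡.cong fromℕ (m∸n+n≡m+[n∸m] m n))) (fromℕ-+ m (n ℕ.∸ m)))))
      where
      m∸n+n≡m+[n∸m] : ∀ m n → m ℕ.∸ n ℕ.+ n ≡ m ℕ.+ (n ℕ.∸ m)
      m∸n+n≡m+[n∸m] zero    zero    = ≡.refl
      m∸n+n≡m+[n∸m] zero    (suc n) = ≡.refl
      m∸n+n≡m+[n∸m] (suc m) zero    = ≡.refl
      m∸n+n≡m+[n∸m] (suc m) (suc n) =
        ≡.trans (ℕ.+-suc (m ℕ.∸ n) n) (≡.cong suc (m∸n+n≡m+[n∸m] m n))

    differences⟶ℝ : differences -Raw-AlmostCommutative⟶ fromCommutativeRing commutativeRing
    differences⟶ℝ = record
      { ⟦_⟧ = ⟦_⟧ℤ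
      ; +-homo = λ (m , n) (m′ , n′) →
          trans (⟦cancel⟧≈difference (m ℕ.+ m′) (n ℕ.+ n′))
            (trans (+-cong (fromℕ-+ m m′) (-‿cong (fromℕ-+ n n′)))
              (trans ([a+b]-[c+d] _ _ _ _)
                (sym (+-cong (⟦⟧ℤ≈difference m n) (⟦⟧ℤ≈difference m′ n′)))))
      ; *-homo = λ (m , n) (m′ , n′) →
          trans (⟦cancel⟧≈difference (m ℕ.* m′ ℕ.+ n ℕ.* n′) (m ℕ.* n′ ℕ.+ n ℕ.* m′))
            (trans (+-cong (trans (fromℕ-+ (m ℕ.* m′) _) (+-cong (fromℕ-* m m′) (fromℕ-* n n′)))
                (-‿cong (trans (fromℕ-+ (m ℕ.* n′) _) (+-cong (fromℕ-* m n′) (fromℕ-* n m′)))))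
              (trans (sym ([a-b]*[c-d] _ _ _ _))
                (sym (*-cong (⟦⟧ℤ≈difference m n) (⟦⟧ℤ≈difference m′ n′)))))
      ; -‿homo = λ (m , n) → trans (⟦⟧ℤ≈difference n m)
          (sym (trans (-‿cong (⟦⟧ℤ≈difference m n))
            (trans (sym (-‿+-comm _ _)) (trans (+-comm _ _) (+-congʳ (-‿involutive _))))))
      ; 0-homo = refl
      ; 1-homo = refl
      }

    _≟ℤ_ : WeaklyDecidable (Induced-equivalence differences⟶ℝ)
    (m , n) ≟ℤ (m′ , n′) with m ℕ.+ n′ ℕ.≟ m′ ℕ.+ n
    ... | no _   = nothing
    ... | yes eq = just (trans (⟦⟧ℤ≈difference m n) (trans
      (equal-differences _ _ _ _
        (trans (sym (fromℕ-+ m n′)) (trans (reflexive (≡.cong fromℕ eq)) (fromℕ-+ m′ n))))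
      (sym (⟦⟧ℤ≈difference m′ n′))))

  open RingSolver differences (fromCommutativeRing commutativeRing) differences⟶ℝ _≟ℤ_ public
    using (solve; _:+_; _:*_; _:-_; :-_; _:=_; con; Polynomial)

  lit : ∀ {m} → ℕ → Polynomial m
  lit n = con (n , 0)

  ≤-reflexive˘ : ∀ {x y} → y ≈ x → x ≤ y
  ≤-reflexive˘ y≈x = ≤-reflexive (sym y≈x)

  ≰⇒≥ : ∀ {x y} → ¬ (x ≤ y) → y ≤ x
  ≰⇒≥ {x} {y} x≰y with total x y
  ... | inj₁ x≤y = contradiction x≤y x≰y
  ... | inj₂ y≤x = y≤x

  ≰⇒> : ∀ {x y} → ¬ (x ≤ y) → y < x
  ≰⇒> x≰y = ≰⇒≥ x≰y , λ y≈x → x≰y (≤-reflexive˘ y≈x)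

  <⇒≱ : ∀ {x y} → x < y → ¬ (y ≤ x)
  <⇒≱ (x≤y , x≉y) y≤x = x≉y (antisym x≤y y≤x)

  <-≤-trans : ∀ {x y z} → x < y → y ≤ z → x < z
  <-≤-trans (x≤y , x≉y) y≤z =
    ≤-trans x≤y y≤z , λ x≈z → x≉y (antisym x≤y (≤-trans y≤z (≤-reflexive˘ x≈z)))

  ≤-<-trans : ∀ {x y z} → x ≤ y → y < z → x < z
  ≤-<-trans x≤y (y≤z , y≉z) =
    ≤-trans x≤y y≤z , λ x≈z → y≉z (antisym y≤z (≤-trans (≤-reflexive˘ x≈z) x≤y))

  0<1 : 0# < 1#
  0<1 = 0≤1 , 0≉1

  +-mono-≤ : ∀ {x y u v} → x ≤ y → u ≤ v → x + u ≤ y + v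
  +-mono-≤ {y = y} {u} x≤y u≤v = ≤-trans (+-monoˡ-≤ u x≤y) (+-monoʳ-≤ y u≤v)

  +-nonNeg : ∀ {x y} → 0# ≤ x → 0# ≤ y → 0# ≤ x + y
  +-nonNeg 0≤x 0≤y = ≤-trans (≤-reflexive˘ (+-identityʳ 0#)) (+-mono-≤ 0≤x 0≤y)

  0≤y-x : ∀ {x y} → x ≤ y → 0# ≤ y - x
  0≤y-x {x} x≤y = ≤-trans (≤-reflexive˘ (-‿inverseʳ x)) (+-monoˡ-≤ (- x) x≤y)

  -- The ring solver proves identities only. An inequality is handed to it by exhibiting the
  -- difference of the two sides as a visibly nonnegative `z`.
  slack : ∀ {x y z} → 0# ≤ z → y ≈ x + z → x ≤ y
  slack {x} 0≤z y≈x+z = ≤-trans (≤-reflexive˘ (+-identityʳ x))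
    (≤-trans (+-monoʳ-≤ x 0≤z) (≤-reflexive˘ y≈x+z))

  -‿anti-≤ : ∀ {x y} → x ≤ y → - y ≤ - x
  -‿anti-≤ {x} {y} x≤y = slack (0≤y-x x≤y)
    (solve 2 (λ x y → :- x := :- y :+ (y :- x)) refl x y)

  *-monoˡ-≤ : ∀ {z x y} → 0# ≤ z → x ≤ y → x * z ≤ y * z
  *-monoˡ-≤ {z} {x} {y} 0≤z x≤y = slack (*-nonNeg (0≤y-x x≤y) 0≤z)
    (solve 3 (λ x y z → y :* z := x :* z :+ (y :- x) :* z) refl x y z)

  *-monoʳ-≤ : ∀ {z x y} → 0# ≤ z → x ≤ y → z * x ≤ z * y
  *-monoʳ-≤ {z} {x} {y} 0≤z x≤y = slack (*-nonNeg 0≤z (0≤y-x x≤y))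
    (solve 3 (λ x y z → z :* y := z :* x :+ z :* (y :- x)) refl x y z)

  *-mono-≤ : ∀ {x y u v} → 0# ≤ u → 0# ≤ y → x ≤ y → u ≤ v → x * u ≤ y * v
  *-mono-≤ 0≤u 0≤y x≤y u≤v = ≤-trans (*-monoˡ-≤ 0≤u x≤y) (*-monoʳ-≤ 0≤y u≤v)

  square-nonNeg : ∀ x → 0# ≤ x * x
  square-nonNeg x with total 0# x
  ... | inj₁ 0≤x = *-nonNeg 0≤x 0≤x
  ... | inj₂ x≤0 = ≤-trans (*-nonNeg 0≤-x 0≤-x)
    (≤-reflexive (solve 1 (λ x → (:- x) :* (:- x) := x :* x) refl x))
    where
    0≤-x : 0# ≤ - x
    0≤-x = ≤-trans (≤-reflexive˘ -0#≈0#) (-‿anti-≤ x≤0)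

  <⇒≉0 : ∀ {x} → 0# < x → ¬ (x ≈ 0#)
  <⇒≉0 (_ , 0≉x) x≈0 = 0≉x (sym x≈0)

  /-*-cancel : ∀ {y} x → ¬ (y ≈ 0#) → x / y * y ≈ x
  /-*-cancel {y} x y≉0 = begin-equality
    x * y ⁻¹ * y   ≈⟨ *-assoc _ _ _ ⟩
    x * (y ⁻¹ * y) ≈⟨ *-congˡ (trans (*-comm _ _) (⁻¹-inverseʳ y≉0)) ⟩
    x * 1#         ≈⟨ *-identityʳ x ⟩
    x              ∎
    where open ≤-Reasoning

  -- If `y < x`, then `z * (x - y)` is nonnegative as a product and nonpositive by hypothesis, hence
  -- zero. Since `x - y` is invertible, this forces `z ≈ 0#`.
  *-cancelʳ-≤ : ∀ {z x y} → 0# < z → x * z ≤ y * z → x ≤ y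
  *-cancelʳ-≤ {z} {x} {y} 0<z xz≤yz with x ≤? y
  ... | yes x≤y = x≤y
  ... | no  x≰y = contradiction z-zero (<⇒≉0 0<z)
    where
    open ≤-Reasoning
    w : ℝ
    w = x - y
    w≉0 : ¬ (w ≈ 0#)
    w≉0 w≈0 = x≰y (≤-reflexive (begin-equality
      x          ≈⟨ solve 2 (λ x y → x := y :+ (x :- y)) refl x y ⟩
      y + w      ≈⟨ +-congˡ w≈0 ⟩
      y + 0#     ≈⟨ +-identityʳ y ⟩
      y          ∎))
    wz≈0 : z * w ≈ 0#
    wz≈0 = antisym
      (slack (0≤y-x xz≤yz) (solve 3 (λ x y z → lit 0 := z :* (x :- y) :+ (y :* z :- x :* z)) refl x y z))
      (*-nonNeg (proj₁ 0<z) (0≤y-x (≰⇒≥ x≰y)))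
    z-zero : z ≈ 0#
    z-zero = begin-equality
      z              ≈⟨ *-identityʳ z ⟨
      z * 1#         ≈⟨ *-congˡ (⁻¹-inverseʳ w≉0) ⟨
      z * (w * w ⁻¹) ≈⟨ *-assoc _ _ _ ⟨
      z * w * w ⁻¹   ≈⟨ *-congʳ wz≈0 ⟩
      0# * w ⁻¹      ≈⟨ zeroˡ _ ⟩
      0#             ∎

  *-cancelʳ-≈ : ∀ {z x y} → 0# < z → x * z ≈ y * z → x ≈ y
  *-cancelʳ-≈ 0<z xz≈yz = antisym (*-cancelʳ-≤ 0<z (≤-reflexive xz≈yz))
    (*-cancelʳ-≤ 0<z (≤-reflexive˘ xz≈yz))

  *-pos : ∀ {x y} → 0# < x → 0# < y → 0# < x * y
  *-pos {x} {y} 0<x 0<y = ≰⇒> λ xy≤0 → <⇒≱ 0<x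
    (*-cancelʳ-≤ 0<y (≤-trans xy≤0 (≤-reflexive˘ (zeroˡ y))))

  x≈0⇒x⁻¹≈0 : ∀ {x} → x ≈ 0# → x ⁻¹ ≈ 0#
  x≈0⇒x⁻¹≈0 {x} x≈0 with x ≟ 0#
  ... | yes _   = refl
  ... | no  x≉0 = contradiction x≈0 x≉0

  ⁻¹-pos : ∀ {x} → 0# < x → 0# < x ⁻¹
  ⁻¹-pos {x} 0<x = ≰⇒> λ x⁻¹≤0 → <⇒≱ 0<1
    (≤-trans (≤-reflexive˘ (⁻¹-inverseʳ (<⇒≉0 0<x)))
      (≤-trans (*-monoʳ-≤ (proj₁ 0<x) x⁻¹≤0) (≤-reflexive (zeroʳ x))))

  ⁻¹-nonNeg : ∀ {x} → 0# ≤ x → 0# ≤ x ⁻¹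
  ⁻¹-nonNeg {x} 0≤x with x ≟ 0#
  ... | yes _   = ≤-refl
  ... | no  x≉0 = ≤-trans (proj₁ (⁻¹-pos (0≤x , λ 0≈x → x≉0 (sym 0≈x))))
    (≤-reflexive (⁻¹-unique 0≤x x≉0))
    where
    -- Two inverses of `x` agree by cancellation, which identifies `x ⁻¹` with the witness that
    -- `inverse` supplies in this branch.
    ⁻¹-unique : 0# ≤ x → (x≉0 : ¬ (x ≈ 0#)) → x ⁻¹ ≈ proj₁ (inverse x x≉0)
    ⁻¹-unique 0≤x x≉0 = *-cancelʳ-≈ {x} (0≤x , λ 0≈x → x≉0 (sym 0≈x))
      (trans (*-comm _ _) (trans (⁻¹-inverseʳ x≉0)
        (trans (sym (proj₂ (inverse x x≉0))) (*-comm _ _))))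

  /-nonNeg : ∀ {x y} → 0# ≤ x → 0# ≤ y → 0# ≤ x / y
  /-nonNeg 0≤x 0≤y = *-nonNeg 0≤x (⁻¹-nonNeg 0≤y)

  x≤y*z⇒x/z≤y : ∀ {x y z} → 0# < z → x ≤ y * z → x / z ≤ y
  x≤y*z⇒x/z≤y {x} 0<z x≤yz =
    *-cancelʳ-≤ 0<z (≤-trans (≤-reflexive (/-*-cancel x (<⇒≉0 0<z))) x≤yz)

  y*z≤x⇒y≤x/z : ∀ {x y z} → 0# < z → y * z ≤ x → y ≤ x / z
  y*z≤x⇒y≤x/z {x} 0<z yz≤x =
    *-cancelʳ-≤ 0<z (≤-trans yz≤x (≤-reflexive˘ (/-*-cancel x (<⇒≉0 0<z))))

  ∣x∣≤y : ∀ {x y} → x ≤ y → - x ≤ y → ∣ x ∣ᵣ ≤ y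
  ∣x∣≤y = ⊔-lub

  fromℕ-nonNeg : ∀ n → 0# ≤ fromℕ n
  fromℕ-nonNeg zero    = ≤-refl
  fromℕ-nonNeg (suc n) = +-nonNeg 0≤1 (fromℕ-nonNeg n)

  1≤fromℕ-suc : ∀ n → 1# ≤ fromℕ (suc n)
  1≤fromℕ-suc n = slack (fromℕ-nonNeg n) refl

  fromℕ-pos : ∀ {n} → 0 ℕ.< n → 0# < fromℕ n
  fromℕ-pos {suc n} _ = <-≤-trans 0<1 (1≤fromℕ-suc n)

  -- The fuel suffices: `x ≤ fromℕ b` persists when `x` and `b` are both lowered by 1, and at
  -- `b = 0` it says that the answer 0 is large enough.
  x≤⌈x⌉ : ∀ x → x ≤ fromℕ ⌈ x ⌉
  x≤⌈x⌉ x = bounded (proj₁ (archimedean x)) x (proj₂ (archimedean x))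
    where
    bounded : ∀ b x → x ≤ fromℕ b → x ≤ fromℕ (boundedCeiling b x)
    bounded zero    x x≤b = x≤b
    bounded (suc b) x x≤b with x ≤? 0#
    ... | yes x≤0 = x≤0
    ... | no  _   = ≤-trans (≤-reflexive (solve 1 (λ x → x := lit 1 :+ (x :- lit 1)) refl x))
      (+-monoʳ-≤ 1# (bounded b (x - 1#) (≤-trans (+-monoˡ-≤ (- 1#) x≤b)
        (≤-reflexive (solve 1 (λ b → lit 1 :+ b :- lit 1 := b) refl (fromℕ b))))))

  sum-mono-≤ : ∀ {n} {f g : Fin n → ℝ} → (∀ i → f i ≤ g i) → sum f ≤ sum g
  sum-mono-≤ {zero}  f≤g = ≤-refl
  sum-mono-≤ {suc n} f≤g = +-mono-≤ (f≤g zero) (sum-mono-≤ (f≤g ∘ suc))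

  sum-nonNeg : ∀ {n} {f : Fin n → ℝ} → (∀ i → 0# ≤ f i) → 0# ≤ sum f
  sum-nonNeg {zero}  0≤f = ≤-refl
  sum-nonNeg {suc n} 0≤f = +-nonNeg (0≤f zero) (sum-nonNeg (0≤f ∘ suc))

  term≤sum : ∀ {n} {f : Fin n → ℝ} → (∀ i → 0# ≤ f i) → ∀ i → f i ≤ sum f
  term≤sum 0≤f zero    = slack (sum-nonNeg (0≤f ∘ suc)) refl
  term≤sum 0≤f (suc i) = ≤-trans (term≤sum (0≤f ∘ suc) i) (slack (0≤f zero) (+-comm _ _))

  sum-const : ∀ n x → sum {n} (const x) ≈ fromℕ n * x
  sum-const zero    x = sym (zeroˡ x)
  sum-const (suc n) x = trans (+-cong (sym (*-identityˡ x)) (sum-const n x)) (sym (distribʳ x 1# (fromℕ n)))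

-- Exponential inequalities through partial sums, and their link to `ln`.

module Exponential {c ℓ} (R : CompleteOrderedField c ℓ) where

  open OrderedField R

  open MonoidSum *-monoid public using () renaming (sum to product; sum-cong-≋ to product-cong)

  product-nonNeg : ∀ {n} {f : Fin n → ℝ} → (∀ i → 0# ≤ f i) → 0# ≤ product f
  product-nonNeg {zero}  0≤f = 0≤1
  product-nonNeg {suc n} 0≤f = *-nonNeg (0≤f zero) (product-nonNeg (0≤f ∘ suc))

  1≤product : ∀ {n} {f : Fin n → ℝ} → (∀ i → 1# ≤ f i) → 1# ≤ product f
  1≤product {zero}  1≤f = ≤-refl
  1≤product {suc n} 1≤f = ≤-trans (≤-reflexive˘ (*-identityˡ 1#))
    (*-mono-≤ 0≤1 (≤-trans 0≤1 (1≤f zero)) (1≤f zero) (1≤product (1≤f ∘ suc)))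

  product-≤1 : ∀ {n} {f : Fin n → ℝ} → (∀ i → 0# ≤ f i) → (∀ i → f i ≤ 1#) → product f ≤ 1#
  product-≤1 {zero}  0≤f f≤1 = ≤-refl
  product-≤1 {suc n} 0≤f f≤1 = ≤-trans
    (*-mono-≤ (product-nonNeg (0≤f ∘ suc)) 0≤1 (f≤1 zero) (product-≤1 (0≤f ∘ suc) (f≤1 ∘ suc)))
    (≤-reflexive (*-identityˡ 1#))

  product-* : ∀ {n} (f g : Fin n → ℝ) → product (λ i → f i * g i) ≈ product f * product g
  product-* {zero}  f g = sym (*-identityˡ 1#)
  product-* {suc n} f g = trans (*-congˡ (product-* (f ∘ suc) (g ∘ suc)))
    (solve 4 (λ a b p q → a :* b :* (p :* q) := a :* p :* (b :* q)) refl
      (f zero) (g zero) (product (f ∘ suc)) (product (g ∘ suc)))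

  ^-nonNeg : ∀ {x} → 0# ≤ x → ∀ n → 0# ≤ x ^ n
  ^-nonNeg 0≤x zero    = 0≤1
  ^-nonNeg 0≤x (suc n) = *-nonNeg 0≤x (^-nonNeg 0≤x n)

  -- The tangent to the power function at `u` lies below its graph at `v`. In the induction, the
  -- error beyond `v` times the previous one is a multiple of `(u - v)²`.
  ^-convex : ∀ {u v} → 0# ≤ u → 0# ≤ v → ∀ n →
    u ^ suc n ≤ v ^ suc n + fromℕ (suc n) * ((u - v) * u ^ n)
  ^-convex {u} {v} 0≤u 0≤v zero = ≤-reflexive
    (solve 2 (λ u v → u :* lit 1 := v :* lit 1 :+ (lit 1 :+ lit 0) :* ((u :- v) :* lit 1)) refl u v)
  ^-convex {u} {v} 0≤u 0≤v (suc n) = slack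
    (+-nonNeg (0≤y-x (*-monoʳ-≤ 0≤v (^-convex 0≤u 0≤v n)))
      (*-nonNeg (fromℕ-nonNeg (suc n)) (*-nonNeg (square-nonNeg (u - v)) (^-nonNeg 0≤u n))))
    (solve 5 (λ u v N P V → v :* V :+ (lit 1 :+ N) :* ((u :- v) :* (u :* P)) :=
        u :* (u :* P) :+ ((v :* (V :+ N :* ((u :- v) :* P)) :- v :* (u :* P))
          :+ N :* ((u :- v) :* (u :- v) :* P)))
      refl u v (fromℕ (suc n)) (u ^ n) (v ^ suc n))

  expTerm : ℝ → ℕ → ℝ
  expTerm x n = x ^ n / fromℕ (n !)

  fromℕ-!-pos : ∀ n → 0# < fromℕ (n !)
  fromℕ-!-pos n = fromℕ-pos (ℕ.>-nonZero⁻¹ (n !) {{n ℕ.!≢0}})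

  expTerm-nonNeg : ∀ {x} → 0# ≤ x → ∀ n → 0# ≤ expTerm x n
  expTerm-nonNeg 0≤x n = /-nonNeg (^-nonNeg 0≤x n) (proj₁ (fromℕ-!-pos n))

  -- Again a tangent inequality: the derivative of a term of the exponential series is the preceding
  -- term.
  expTerm-convex : ∀ {u v} → 0# ≤ u → 0# ≤ v → ∀ n →
    expTerm u (suc n) ≤ expTerm v (suc n) + (u - v) * expTerm u n
  expTerm-convex {u} {v} 0≤u 0≤v n = begin
    u ^ suc n * J′
      ≤⟨ *-monoˡ-≤ (⁻¹-nonNeg (proj₁ (fromℕ-!-pos (suc n)))) (^-convex 0≤u 0≤v n) ⟩
    (v ^ suc n + N * ((u - v) * u ^ n)) * J′
      ≈⟨ solve 6 (λ V N u v U J′ → (V :+ N :* ((u :- v) :* U)) :* J′ := V :* J′ :+ (u :- v) :* (U :* (N :* J′)))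
           refl (v ^ suc n) N u v (u ^ n) J′ ⟩
    v ^ suc n * J′ + (u - v) * (u ^ n * (N * J′))
      ≈⟨ +-congˡ (*-congˡ (*-congˡ N*J′≈J)) ⟩
    v ^ suc n * J′ + (u - v) * (u ^ n * J) ∎
    where
    open ≤-Reasoning
    N J J′ : ℝ
    N  = fromℕ (suc n)
    J  = fromℕ (n !) ⁻¹
    J′ = fromℕ (suc n !) ⁻¹
    N*J′≈J : N * J′ ≈ J
    N*J′≈J = *-cancelʳ-≈ (fromℕ-!-pos n) (begin-equality
      N * J′ * fromℕ (n !)    ≈⟨ solve 3 (λ N J F → N :* J :* F := (N :* F) :* J) refl N J′ (fromℕ (n !)) ⟩
      N * fromℕ (n !) * J′    ≈⟨ *-congʳ (fromℕ-* (suc n) (n !)) ⟨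
      fromℕ (suc n !) * J′    ≈⟨ ⁻¹-inverseʳ (<⇒≉0 (fromℕ-!-pos (suc n))) ⟩
      1#                      ≈⟨ ⁻¹-inverseʳ (<⇒≉0 (fromℕ-!-pos n)) ⟨
      fromℕ (n !) * J         ≈⟨ *-comm _ _ ⟩
      J * fromℕ (n !)         ∎)

  sum-init : (f : ℕ → ℝ) → (∀ i → 0# ≤ f i) → ∀ n → sum {n} (f ∘ toℕ) ≤ sum {suc n} (f ∘ toℕ)
  sum-init f 0≤f zero    = +-nonNeg (0≤f 0) ≤-refl
  sum-init f 0≤f (suc n) = +-monoʳ-≤ (f 0) (sum-init (f ∘ suc) (0≤f ∘ suc) n)

  -- A truncation of `(1 - r) eʳ ≤ 1`, multiplied by `eᵛ`. It is the tangent inequality at `v + r`,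
  -- summed over the terms; the index shifts because the derivative of a partial sum has one term
  -- fewer. Negative `r` is allowed, so it also serves for `1 + x ≤ eˣ`.
  expSum-tilt : ∀ {v r} → 0# ≤ v → 0# ≤ v + r → ∀ n →
    (1# - r) * expSum n (v + r) ≤ expSum (suc n) v
  expSum-tilt {v} {r} 0≤v 0≤u n = begin
    (1# - r) * E
      ≈⟨ solve 2 (λ r E → (lit 1 :- r) :* E := E :- r :* E) refl r E ⟩
    E - r * E
      ≤⟨ +-monoˡ-≤ (- (r * E)) (sum-init (expTerm u) (expTerm-nonNeg 0≤u) n) ⟩
    expSum (suc n) u - r * E
      ≤⟨ +-monoˡ-≤ (- (r * E)) expSum-convex ⟩
    (expSum (suc n) v + r * E) - r * E
      ≈⟨ solve 2 (λ a b → a :+ b :- b := a) refl (expSum (suc n) v) (r * E) ⟩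
    expSum (suc n) v ∎
    where
    open ≤-Reasoning
    u E : ℝ
    u = v + r
    E = expSum n u
    expSum-convex : expSum (suc n) u ≤ expSum (suc n) v + r * E
    expSum-convex = begin
      expTerm u 0 + sum {n} (λ i → expTerm u (suc (toℕ i)))
        ≤⟨ +-monoʳ-≤ (expTerm u 0) (sum-mono-≤ {n} (λ i → expTerm-convex 0≤u 0≤v (toℕ i))) ⟩
      expTerm v 0 + sum {n} (λ i → expTerm v (suc (toℕ i)) + (u - v) * expTerm u (toℕ i))
        ≈⟨ +-congˡ (∑-distrib-+ {n} (λ i → expTerm v (suc (toℕ i))) (λ i → (u - v) * expTerm u (toℕ i))) ⟩
      expTerm v 0 + (sum {n} (λ i → expTerm v (suc (toℕ i))) + sum {n} (λ i → (u - v) * expTerm u (toℕ i)))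
        ≈⟨ +-assoc _ _ _ ⟨
      expSum (suc n) v + sum {n} (λ i → (u - v) * expTerm u (toℕ i))
        ≈⟨ +-congˡ (*-distribˡ-sum {n} (u - v) (λ i → expTerm u (toℕ i))) ⟨
      expSum (suc n) v + (u - v) * E
        ≈⟨ +-congˡ (*-congʳ (solve 2 (λ v r → v :+ r :- v := r) refl v r)) ⟩
      expSum (suc n) v + r * E ∎

  expSum-mono-≤ : ∀ {x y} → 0# ≤ x → x ≤ y → ∀ n → expSum n x ≤ expSum n y
  expSum-mono-≤ {x} {y} 0≤x x≤y n = sum-mono-≤ {n} (λ i →
    *-monoˡ-≤ (⁻¹-nonNeg (proj₁ (fromℕ-!-pos (toℕ i)))) (^-mono-≤ (toℕ i)))
    where
    ^-mono-≤ : ∀ n → x ^ n ≤ y ^ n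
    ^-mono-≤ zero    = ≤-refl
    ^-mono-≤ (suc n) = *-mono-≤ (^-nonNeg 0≤x n) (≤-trans 0≤x x≤y) x≤y (^-mono-≤ n)

  expSum-0 : ∀ n → expSum n 0# ≤ 1#
  expSum-0 n = proj₂ (proj₂ (Exp≤-inhabited ≤-refl)) n

  -- m eˣ ≤ 1, expressed by partial sums.  As v ranges over the numbers with
  -- v + x ≥ 0, m e^{v+x} ≤ eᵛ makes sense for negative x, and multiplies.
  infix 4 _*exp_≤1
  _*exp_≤1 : ℝ → ℝ → Set _
  m *exp x ≤1 = ∀ {v} → 0# ≤ v → 0# ≤ v + x → ∀ n → ∃ λ N → m * expSum n (v + x) ≤ expSum N v

  [1-x]*exp≤1 : ∀ x → 1# - x *exp x ≤1
  [1-x]*exp≤1 x 0≤v 0≤v+x n = suc n , expSum-tilt 0≤v 0≤v+x n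

  0*exp≤1 : ∀ {m} x → m ≈ 0# → m *exp x ≤1
  0*exp≤1 x m≈0 _ _ n = 0 , ≤-reflexive (trans (*-congʳ m≈0) (zeroˡ _))

  1*exp0≤1 : 1# *exp 0# ≤1
  1*exp0≤1 {v} 0≤v 0≤v+0 n = n , ≤-trans (≤-reflexive (*-identityˡ _))
    (expSum-mono-≤ 0≤v+0 (≤-reflexive (+-identityʳ v)) n)

  expSum-nonNeg : ∀ {x} → 0# ≤ x → ∀ n → 0# ≤ expSum n x
  expSum-nonNeg 0≤x n = sum-nonNeg {n} (λ i → expTerm-nonNeg 0≤x (toℕ i))

  *exp-anti : ∀ {m m′ x x′} → 0# ≤ m → m′ ≤ m → x′ ≤ x → m *exp x ≤1 → m′ *exp x′ ≤1
  *exp-anti {m} {m′} {x} {x′} 0≤m m′≤m x′≤x m*eˣ≤1 {v} 0≤v 0≤v+x′ n =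
    let 0≤v+x = ≤-trans 0≤v+x′ (+-monoʳ-≤ v x′≤x)
        N , bound = m*eˣ≤1 0≤v 0≤v+x n
    in N , ≤-trans (*-mono-≤ (expSum-nonNeg 0≤v+x′ n) 0≤m m′≤m
      (expSum-mono-≤ 0≤v+x′ (+-monoʳ-≤ v x′≤x) n)) bound

  *-*exp : ∀ {m₁ m₂ x₁ x₂} → 0# ≤ m₁ → 0# ≤ m₂ →
    m₁ *exp x₁ ≤1 → m₂ *exp x₂ ≤1 → m₁ * m₂ *exp x₁ + x₂ ≤1
  *-*exp {m₁} {m₂} {x₁} {x₂} 0≤m₁ 0≤m₂ bound₁ bound₂ {v} 0≤v 0≤v+x n =
    let N , ineq = either
    in N , ≤-trans (*-monoʳ-≤ (*-nonNeg 0≤m₁ 0≤m₂)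
      (expSum-mono-≤ 0≤v+x (≤-reflexive˘ (+-assoc v x₁ x₂)) n)) ineq
    where
    compose : ∀ {m₁ m₂ x₁ x₂} → 0# ≤ m₁ → m₁ *exp x₁ ≤1 → m₂ *exp x₂ ≤1 →
      0# ≤ v + x₁ → 0# ≤ v + x₁ + x₂ →
      ∃ λ N → m₁ * (m₂ * expSum n (v + x₁ + x₂)) ≤ expSum N v
    compose 0≤m₁ bound₁ bound₂ 0≤v+x₁ 0≤v+x₁+x₂ =
      let N , ineq  = bound₂ 0≤v+x₁ 0≤v+x₁+x₂ n
          M , ineq′ = bound₁ 0≤v 0≤v+x₁ N
      in M , ≤-trans (*-monoʳ-≤ 0≤m₁ ineq) ineq′
    0≤v+x₁+x₂ : 0# ≤ v + x₁ + x₂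
    0≤v+x₁+x₂ = ≤-trans 0≤v+x (≤-reflexive˘ (+-assoc v x₁ x₂))
    swap : v + x₁ + x₂ ≈ v + x₂ + x₁
    swap = solve 3 (λ v x y → v :+ x :+ y := v :+ y :+ x) refl v x₁ x₂
    -- At least one of the two orders keeps the intermediate exponent nonnegative.
    either : ∃ λ N → m₁ * m₂ * expSum n (v + x₁ + x₂) ≤ expSum N v
    either with total 0# (v + x₁)
    ... | inj₁ 0≤v+x₁ =
      let N , ineq = compose 0≤m₁ bound₁ bound₂ 0≤v+x₁ 0≤v+x₁+x₂
      in N , ≤-trans (≤-reflexive (*-assoc _ _ _)) ineq
    ... | inj₂ v+x₁≤0 =
      let 0≤x₂ = ≤-trans 0≤v+x₁+x₂ (≤-trans (+-monoˡ-≤ x₂ v+x₁≤0) (≤-reflexive (+-identityˡ x₂)))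
          N , ineq = compose 0≤m₂ bound₂ bound₁ (+-nonNeg 0≤v 0≤x₂) (≤-trans 0≤v+x₁+x₂ (≤-reflexive swap))
      in N , ≤-trans (*-monoʳ-≤ (*-nonNeg 0≤m₁ 0≤m₂) (expSum-mono-≤ 0≤v+x₁+x₂ (≤-reflexive swap) n))
        (≤-trans (≤-reflexive (trans (*-congʳ (*-comm m₁ m₂)) (*-assoc _ _ _))) ineq)

  ln-upper : ∀ {x y} → 1# ≤ y → Exp≤ y x → x ≤ ln y
  ln-upper {x} {y} 1≤y eˣ≤y with 1# ≤? y | 1# ≤? y ⁻¹
  ... | yes 1≤y′ | _ =
    proj₁ (proj₂ (complete (Exp≤ y) (Exp≤-inhabited 1≤y′) (y , Exp≤-bounded y))) x eˣ≤y
  ... | no 1≰y | _ = contradiction 1≤y 1≰y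

  ln-nonNeg : ∀ {y} → 1# ≤ y → 0# ≤ ln y
  ln-nonNeg 1≤y = ln-upper 1≤y (≤-refl , λ n → ≤-trans (expSum-0 n) 1≤y)

  -- Takes the place of `e^(ln y) = y`. If `m * y > 1`, put `η = 1 - 1/(m y) > 0`. Then
  -- `e^(x + η) ≤ eˣ / (1 - η) = eˣ m y ≤ y` for all partial sums, so `x + η` competes in the
  -- supremum defining `ln y`, and `x + η ≤ ln y ≤ x` is absurd.
  *exp≤1⇒*≤1 : ∀ {m x y} → 0# ≤ m → 1# ≤ y → m *exp x ≤1 → ln y ≤ x → m * y ≤ 1#
  *exp≤1⇒*≤1 {m} {x} {y} 0≤m 1≤y m*eˣ≤1 ln[y]≤x with m * y ≤? 1#
  ... | yes my≤1 = my≤1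
  ... | no  my≰1 = contradiction (x+η≤x⇒my≤1 (≤-trans (ln-upper 1≤y (0≤x+η , exp≤y)) ln[y]≤x)) my≰1
    where
    open ≤-Reasoning
    q η : ℝ
    q = (m * y) ⁻¹
    η = 1# - q
    0<my : 0# < m * y
    0<my = ≤-<-trans 0≤1 (≰⇒> my≰1)
    myq≈1 : m * y * q ≈ 1#
    myq≈1 = ⁻¹-inverseʳ (<⇒≉0 0<my)
    q≤1 : q ≤ 1#
    q≤1 = *-cancelʳ-≤ 0<my (begin
      q * (m * y)  ≈⟨ trans (*-comm _ _) myq≈1 ⟩
      1#           ≤⟨ ≰⇒≥ my≰1 ⟩
      m * y        ≈⟨ *-identityˡ _ ⟨
      1# * (m * y) ∎)
    0≤x : 0# ≤ x
    0≤x = ≤-trans (ln-nonNeg 1≤y) ln[y]≤x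
    0≤x+η : 0# ≤ x + η
    0≤x+η = +-nonNeg 0≤x (0≤y-x q≤1)
    m*expSum≤1 : ∀ n → m * expSum n x ≤ 1#
    m*expSum≤1 n =
      let 0+x≈x = +-identityˡ x
          N , bound = m*eˣ≤1 ≤-refl (≤-trans 0≤x (≤-reflexive˘ 0+x≈x)) n
      in ≤-trans (*-monoʳ-≤ 0≤m (expSum-mono-≤ 0≤x (≤-reflexive˘ 0+x≈x) n)) (≤-trans bound (expSum-0 N))
    exp≤y : ∀ n → expSum n (x + η) ≤ y
    exp≤y n = begin
      E                        ≈⟨ *-identityˡ E ⟨
      1# * E                   ≈⟨ *-congʳ myq≈1 ⟨
      m * y * q * E            ≈⟨ solve 4 (λ m y q E → m :* y :* q :* E := y :* (m :* ((lit 1 :- (lit 1 :- q)) :* E))) refl m y q E ⟩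
      y * (m * ((1# - η) * E)) ≤⟨ *-monoʳ-≤ 0≤y (*-monoʳ-≤ 0≤m (expSum-tilt 0≤x 0≤x+η n)) ⟩
      y * (m * expSum (suc n) x) ≤⟨ *-monoʳ-≤ 0≤y (m*expSum≤1 (suc n)) ⟩
      y * 1#                   ≈⟨ *-identityʳ y ⟩
      y                        ∎
      where
      E : ℝ
      E = expSum n (x + η)
      0≤y : 0# ≤ y
      0≤y = ≤-trans 0≤1 1≤y
    x+η≤x⇒my≤1 : x + η ≤ x → m * y ≤ 1#
    x+η≤x⇒my≤1 x+η≤x = begin
      m * y       ≈⟨ *-identityʳ _ ⟨
      m * y * 1#  ≤⟨ *-monoʳ-≤ (proj₁ 0<my) (slack (0≤y-x x+η≤x)
          (solve 2 (λ x q → q := lit 1 :+ (x :- (x :+ (lit 1 :- q)))) refl x q)) ⟩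
      m * y * q   ≈⟨ myq≈1 ⟩
      1#          ∎

  product-*exp : ∀ {n} {m x : Fin n → ℝ} → (∀ i → 0# ≤ m i) →
    (∀ i → m i *exp x i ≤1) → product m *exp sum x ≤1
  product-*exp {zero}  0≤m bounds = 1*exp0≤1
  product-*exp {suc n} 0≤m bounds = *-*exp (0≤m zero) (product-nonNeg (0≤m ∘ suc))
    (bounds zero) (product-*exp (0≤m ∘ suc) (bounds ∘ suc))

-- Expectations over finite experiments, independence and Markov's inequality.

module Expectation {c ℓ} (R : CompleteOrderedField c ℓ) where

  open OrderedField R
  open Exponential R
  open Probability R public

  private
    variable
      a b p q : Level
      A B : Set a

  𝟙 : {P : Set p} → Dec P → ℝ
  𝟙 P? = if does P? then 1# else 0#

  𝟙-true : {P : Set p} (P? : Dec P) → P → 𝟙 P? ≈ 1#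
  𝟙-true (yes _) _ = refl
  𝟙-true (no ¬p) p = contradiction p ¬p

  𝟙-false : {P : Set p} (P? : Dec P) → ¬ P → 𝟙 P? ≈ 0#
  𝟙-false (no _)  _  = refl
  𝟙-false (yes p) ¬p = contradiction p ¬p

  𝟙-nonNeg : {P : Set p} (P? : Dec P) → 0# ≤ 𝟙 P?
  𝟙-nonNeg (yes _) = 0≤1
  𝟙-nonNeg (no _)  = ≤-refl

  𝟙≤1 : {P : Set p} (P? : Dec P) → 𝟙 P? ≤ 1#
  𝟙≤1 (yes _) = ≤-refl
  𝟙≤1 (no _)  = 0≤1

  𝟙≤ : {P : Set p} (P? : Dec P) {x : ℝ} → 0# ≤ x → (P → 1# ≤ x) → 𝟙 P? ≤ x
  𝟙≤ (yes p) _   1≤x = 1≤x p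
  𝟙≤ (no _)  0≤x _   = 0≤x

  -- Linearity and the product rule hold for arbitrary real weights. Nonnegativity of the weights
  -- enters through `Supported`, and total weight 1 through `Mass1`.
  𝔼 : Dist A → (A → ℝ) → ℝ
  𝔼 μ f = foldr (λ (w , x) → w * f x +_) 0# μ

  Pr≈𝔼 : (μ : Dist A) {P : Pred A p} (P? : Decidable P) → Pr μ P? ≈ 𝔼 μ (𝟙 ∘ P?)
  Pr≈𝔼 [] P? = refl
  Pr≈𝔼 ((w , x) ∷ μ) P? with P? x
  ... | yes _ = +-cong (sym (*-identityʳ w)) (Pr≈𝔼 μ P?)
  ... | no _  = trans (Pr≈𝔼 μ P?) (sym (trans (+-congʳ (zeroʳ w)) (+-identityˡ _)))

  𝔼-cong : (μ : Dist A) {f g : A → ℝ} → (∀ x → f x ≈ g x) → 𝔼 μ f ≈ 𝔼 μ g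
  𝔼-cong []            f≈g = refl
  𝔼-cong ((w , x) ∷ μ) f≈g = +-cong (*-congˡ (f≈g x)) (𝔼-cong μ f≈g)

  𝔼-* : (μ : Dist A) (f : A → ℝ) (r : ℝ) → 𝔼 μ (λ x → r * f x) ≈ r * 𝔼 μ f
  𝔼-* []            f r = sym (zeroʳ r)
  𝔼-* ((w , x) ∷ μ) f r = trans (+-congˡ (𝔼-* μ f r))
    (solve 4 (λ w r y z → w :* (r :* y) :+ r :* z := r :* (w :* y :+ z)) refl w r (f x) (𝔼 μ f))

  𝔼-+ : (μ : Dist A) (f g : A → ℝ) → 𝔼 μ (λ x → f x + g x) ≈ 𝔼 μ f + 𝔼 μ g
  𝔼-+ []            f g = sym (+-identityˡ 0#)
  𝔼-+ ((w , x) ∷ μ) f g = trans (+-congˡ (𝔼-+ μ f g))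
    (solve 5 (λ w y z s t → w :* (y :+ z) :+ (s :+ t) := (w :* y :+ s) :+ (w :* z :+ t)) refl
      w (f x) (g x) (𝔼 μ f) (𝔼 μ g))

  𝔼-0 : (μ : Dist A) → 𝔼 μ (const 0#) ≈ 0#
  𝔼-0 []            = refl
  𝔼-0 ((w , x) ∷ μ) = trans (+-cong (zeroʳ w) (𝔼-0 μ)) (+-identityʳ 0#)

  𝔼-sum : ∀ {n} (μ : Dist A) (f : Fin n → A → ℝ) →
    𝔼 μ (λ x → sum (λ i → f i x)) ≈ sum (λ i → 𝔼 μ (f i))
  𝔼-sum {n = zero}  μ f = 𝔼-0 μ
  𝔼-sum {n = suc n} μ f = trans (𝔼-+ μ (f zero) _) (+-congˡ (𝔼-sum μ (f ∘ suc)))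

  𝔼-++ : (μ ν : Dist A) (f : A → ℝ) → 𝔼 (μ ++ ν) f ≈ 𝔼 μ f + 𝔼 ν f
  𝔼-++ []            ν f = sym (+-identityˡ _)
  𝔼-++ ((w , x) ∷ μ) ν f = trans (+-congˡ (𝔼-++ μ ν f)) (sym (+-assoc _ _ _))

  𝔼-rescale : (w : ℝ) (μ : Dist A) (f : A → ℝ) → 𝔼 (map (λ (v , y) → (w * v , y)) μ) f ≈ w * 𝔼 μ f
  𝔼-rescale w []            f = sym (zeroʳ w)
  𝔼-rescale w ((v , x) ∷ μ) f = trans (+-congˡ (𝔼-rescale w μ f))
    (solve 4 (λ w v y z → w :* v :* y :+ w :* z := w :* (v :* y :+ z)) refl w v (f x) (𝔼 μ f))

  𝔼->>= : (μ : Dist A) (κ : A → Dist B) (f : B → ℝ) → 𝔼 (μ >>= κ) f ≈ 𝔼 μ (λ x → 𝔼 (κ x) f)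
  𝔼->>= []            κ f = refl
  𝔼->>= ((w , x) ∷ μ) κ f = trans (𝔼-++ (map _ (κ x)) (μ >>= κ) f)
    (+-cong (𝔼-rescale w (κ x) f) (𝔼->>= μ κ f))

  𝔼-return : (x : A) (f : A → ℝ) → 𝔼 (return x) f ≈ f x
  𝔼-return x f = trans (+-identityʳ _) (*-identityˡ _)

  𝔼-bernoulli : (r : ℝ) (f : Bool → ℝ) → 𝔼 (bernoulli r) f ≈ r * f true + (1# - r) * f false
  𝔼-bernoulli r f = +-congˡ (+-identityʳ _)

  -- Outcomes of weight 0 may violate Q: bernoulli 1# still lists false.
  Supported : Pred A q → Dist A → Set _
  Supported Q = All (λ (w , x) → 0# ≤ w × (w ≈ 0# ⊎ Q x))

  𝔼-mono-≤ : {Q : Pred A q} {μ : Dist A} {f g : A → ℝ} → Supported Q μ →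
    (∀ x → Q x → f x ≤ g x) → 𝔼 μ f ≤ 𝔼 μ g
  𝔼-mono-≤ [] f≤g = ≤-refl
  𝔼-mono-≤ ((0≤w , inj₁ w≈0) ∷ Qμ) f≤g = +-mono-≤
    (≤-reflexive (trans (trans (*-congʳ w≈0) (zeroˡ _)) (sym (trans (*-congʳ w≈0) (zeroˡ _)))))
    (𝔼-mono-≤ Qμ f≤g)
  𝔼-mono-≤ ((0≤w , inj₂ Qx) ∷ Qμ) f≤g = +-mono-≤ (*-monoʳ-≤ 0≤w (f≤g _ Qx)) (𝔼-mono-≤ Qμ f≤g)

  Supported-return : {Q : Pred A q} {x : A} → Q x → Supported Q (return x)
  Supported-return Qx = (0≤1 , inj₂ Qx) ∷ []

  Supported->>= : {Q : Pred A p} {Q′ : Pred B q} {μ : Dist A} {κ : A → Dist B} →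
    Supported Q μ → (∀ {x} → Q x → Supported Q′ (κ x)) → Supported Q′ (μ >>= κ)
  Supported->>= [] Qκ = []
  Supported->>= {Q = Q} {Q′} {(w , x) ∷ _} {κ} ((0≤w , Qx) ∷ Qμ) Qκ =
    All.++⁺ (All.map⁺ (rescaled Qx)) (Supported->>= Qμ Qκ)
    where
    rescaled : w ≈ 0# ⊎ Q x → All (λ (v , y) → 0# ≤ w * v × (w * v ≈ 0# ⊎ Q′ y)) (κ x)
    rescaled (inj₁ w≈0) = All.universal
      (λ _ → let wv≈0 = trans (*-congʳ w≈0) (zeroˡ _) in ≤-reflexive˘ wv≈0 , inj₁ wv≈0) (κ x)
    rescaled (inj₂ Qx) = All.map (λ where
      (0≤v , inj₁ v≈0) → *-nonNeg 0≤w 0≤v , inj₁ (trans (*-congˡ v≈0) (zeroʳ w))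
      (0≤v , inj₂ Q′y) → *-nonNeg 0≤w 0≤v , inj₂ Q′y) (Qκ Qx)

  Mass1 : Dist A → Set _
  Mass1 μ = 𝔼 μ (const 1#) ≈ 1#

  𝔼-const : (μ : Dist A) → Mass1 μ → ∀ r → 𝔼 μ (const r) ≈ r
  𝔼-const μ mass r = begin-equality
    𝔼 μ (const r)         ≈⟨ 𝔼-cong μ (λ _ → *-identityʳ r) ⟨
    𝔼 μ (const (r * 1#))  ≈⟨ 𝔼-* μ (const 1#) r ⟩
    r * 𝔼 μ (const 1#)    ≈⟨ *-congˡ mass ⟩
    r * 1#                ≈⟨ *-identityʳ r ⟩
    r                     ∎
    where open ≤-Reasoning

  Mass1-return : (x : A) → Mass1 (return x)
  Mass1-return x = 𝔼-return x (const 1#)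

  Mass1->>= : (μ : Dist A) (κ : A → Dist B) → Mass1 μ → (∀ x → Mass1 (κ x)) → Mass1 (μ >>= κ)
  Mass1->>= μ κ mass masses = trans (𝔼->>= μ κ (const 1#)) (trans (𝔼-cong μ masses) mass)

  Mass1-bernoulli : ∀ r → Mass1 (bernoulli r)
  Mass1-bernoulli r = trans (𝔼-bernoulli r (const 1#))
    (solve 1 (λ r → r :* lit 1 :+ (lit 1 :- r) :* lit 1 := lit 1) refl r)

  𝔼-∷ : ∀ {n} (μ : Fin (suc n) → Dist A) (f : Vec A (suc n) → ℝ) →
    𝔼 (independently μ) f ≈ 𝔼 (μ zero) (λ x → 𝔼 (independently (μ ∘ suc)) (λ xs → f (x ∷ xs)))
  𝔼-∷ μ f = trans (𝔼->>= (μ zero) _ f) (𝔼-cong (μ zero) λ x →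
    trans (𝔼->>= (independently (μ ∘ suc)) (λ xs → return (x ∷ xs)) f)
      (𝔼-cong (independently (μ ∘ suc)) λ xs → 𝔼-return (x ∷ xs) f))

  Mass1-independently : ∀ {n} (μ : Fin n → Dist A) → (∀ i → Mass1 (μ i)) → Mass1 (independently μ)
  Mass1-independently {A = A} {n = zero} μ masses = Mass1-return {A = Vec A 0} []
  Mass1-independently {n = suc n} μ masses = trans (𝔼-∷ μ (const 1#))
    (trans (𝔼-cong (μ zero) (λ _ → Mass1-independently (μ ∘ suc) (masses ∘ suc))) (masses zero))

  -- The marginal of one coordinate: the other coordinates integrate to their mass 1.
  𝔼-lookup : ∀ {n} (μ : Fin n → Dist A) → (∀ i → Mass1 (μ i)) → (i : Fin n) (f : A → ℝ) →
    𝔼 (independently μ) (λ xs → f (lookup xs i)) ≈ 𝔼 (μ i) f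
  𝔼-lookup μ masses zero f = trans (𝔼-∷ μ _) (𝔼-cong (μ zero) λ x →
    𝔼-const (independently (μ ∘ suc)) (Mass1-independently (μ ∘ suc) (masses ∘ suc)) (f x))
  𝔼-lookup μ masses (suc i) f = trans (𝔼-∷ μ _)
    (trans (𝔼-cong (μ zero) λ x → 𝔼-lookup (μ ∘ suc) (masses ∘ suc) i f)
      (𝔼-const (μ zero) (masses zero) _))

  𝔼-product : ∀ {n} (μ : Fin n → Dist A) (f : Fin n → A → ℝ) →
    𝔼 (independently μ) (λ xs → product (λ i → f i (lookup xs i))) ≈ product (λ i → 𝔼 (μ i) (f i))
  𝔼-product {A = A} {n = zero} μ f = 𝔼-return {A = Vec A 0} [] (const 1#)
  𝔼-product {n = suc n} μ f = begin-equality
    𝔼 (independently μ) (λ xs → product (λ i → f i (lookup xs i)))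
      ≈⟨ 𝔼-∷ μ _ ⟩
    𝔼 (μ zero) (λ x → 𝔼 ν (λ xs → f zero x * F xs))
      ≈⟨ 𝔼-cong (μ zero) (λ x → trans (𝔼-* ν F (f zero x)) (*-comm _ _)) ⟩
    𝔼 (μ zero) (λ x → 𝔼 ν F * f zero x)
      ≈⟨ 𝔼-* (μ zero) (f zero) (𝔼 ν F) ⟩
    𝔼 ν F * 𝔼 (μ zero) (f zero)
      ≈⟨ *-comm _ _ ⟩
    𝔼 (μ zero) (f zero) * 𝔼 ν F
      ≈⟨ *-congˡ (𝔼-product (μ ∘ suc) (f ∘ suc)) ⟩
    product (λ i → 𝔼 (μ i) (f i)) ∎
    where
    open ≤-Reasoning
    ν = independently (μ ∘ suc)
    F : Vec _ n → ℝ
    F xs = product (λ i → f (suc i) (lookup xs i))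

  Supported-independently : ∀ {n} {μ : Fin n → Dist A} {Q : Fin n → Pred A q} →
    (∀ i → Supported (Q i) (μ i)) → Supported (λ xs → ∀ i → Q i (lookup xs i)) (independently μ)
  Supported-independently {n = zero}  Qμ = Supported-return λ ()
  Supported-independently {n = suc n} Qμ = Supported->>= (Qμ zero) λ Qx →
    Supported->>= (Supported-independently (Qμ ∘ suc)) λ Qxs →
      Supported-return λ { zero → Qx ; (suc i) → Qxs i }

  -- Here `r` is the inclusion probability, `b` membership in the set sampled from and `c` the
  -- outcome. The second half says that an element of probability 1 is never dropped, so that its
  -- contribution to the estimate is exact.
  Possible : ℝ → Bool → Pred Bool _
  Possible r b c = (c ≡ true → b ≡ true) × (b ≡ true → r ≈ 1# → c ≡ true)

  module _ {n} (S : Subset n) (r : Fin n → ℝ) where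

    inclusion : Fin n → Dist Bool
    inclusion e = if lookup S e then bernoulli (r e) else return false

    Mass1-inclusion : ∀ e → Mass1 (inclusion e)
    Mass1-inclusion e with lookup S e
    ... | true  = Mass1-bernoulli (r e)
    ... | false = Mass1-return false

    Mass1-randomSubset : Mass1 (randomSubset S r)
    Mass1-randomSubset = Mass1-independently inclusion Mass1-inclusion

    IsSample : Pred (Subset n) _
    IsSample F = ∀ e → Possible (r e) (lookup S e) (lookup F e)

    module _ (0≤r : ∀ e → 0# ≤ r e) (r≤1 : ∀ e → r e ≤ 1#) where

      Supported-inclusion : ∀ e → Supported (Possible (r e) (lookup S e)) (inclusion e)
      Supported-inclusion e with lookup S e
      ... | false = Supported-return ((λ ()) , λ ())
      ... | true  = (0≤r e , inj₂ ((λ _ → ≡.refl) , λ _ _ → ≡.refl)) ∷ (0≤y-x (r≤1 e) , excluded) ∷ []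
        where
        excluded : 1# - r e ≈ 0# ⊎ Possible (r e) true false
        excluded with r e ≟ 1#
        ... | yes r≈1 = inj₁ (trans (+-congˡ (-‿cong r≈1)) (-‿inverseʳ 1#))
        ... | no  r≉1 = inj₂ ((λ ()) , λ _ r≈1 → contradiction r≈1 r≉1)

      Supported-randomSubset : Supported IsSample (randomSubset S r)
      Supported-randomSubset = Supported-independently Supported-inclusion

  -- Dominating the event by a product with one factor per coordinate lets independence evaluate the
  -- bound. The domination is asked for on possible outcomes only. It serves both the Chernoff
  -- bound, with tilted weights, and the missed pivots, with 0-1 factors.
  markov : ∀ {n} {μ : Fin n → Dist A} {Q : Fin n → Pred A q} {P : Pred (Vec A n) p} (P? : Decidable P)
    (f : Fin n → A → ℝ) (Y : ℝ) → 0# ≤ Y → (∀ i → Supported (Q i) (μ i)) → (∀ i x → 0# ≤ f i x) →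
    (∀ xs → (∀ i → Q i (lookup xs i)) → P xs → Y ≤ product (λ i → f i (lookup xs i))) →
    Y * 𝔼 (independently μ) (𝟙 ∘ P?) ≤ product (λ i → 𝔼 (μ i) (f i))
  markov {μ = μ} P? f Y 0≤Y Qμ 0≤f Y≤f = begin
    Y * 𝔼 (independently μ) (𝟙 ∘ P?)
      ≈⟨ 𝔼-* (independently μ) (𝟙 ∘ P?) Y ⟨
    𝔼 (independently μ) (λ xs → Y * 𝟙 (P? xs))
      ≤⟨ 𝔼-mono-≤ (Supported-independently Qμ) pointwise ⟩
    𝔼 (independently μ) (λ xs → product (λ i → f i (lookup xs i)))
      ≈⟨ 𝔼-product μ f ⟩
    product (λ i → 𝔼 (μ i) (f i)) ∎
    where
    open ≤-Reasoning
    pointwise : ∀ xs → _ → Y * 𝟙 (P? xs) ≤ product (λ i → f i (lookup xs i))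
    pointwise xs Qxs with P? xs
    ... | yes Pxs = ≤-trans (≤-reflexive (*-identityʳ Y)) (Y≤f xs Qxs Pxs)
    ... | no _    = ≤-trans (≤-reflexive (zeroʳ Y)) (product-nonNeg (λ i → 0≤f i (lookup xs i)))

-- Sums and maxima over subsets.

module SumOver {c ℓ} (R : CompleteOrderedField c ℓ) where

  open OrderedField R
  open ≤-Reasoning

  restrict : Bool → ℝ → ℝ
  restrict b x = if b then x else 0#

  restrict-nonNeg : ∀ b {x} → 0# ≤ x → 0# ≤ restrict b x
  restrict-nonNeg true  0≤x = 0≤x
  restrict-nonNeg false 0≤x = ≤-refl

  module _ {n} (S : Subset n) where

    sumOver-mono-≤ : ∀ {f g} → (∀ e → lookup S e ≡ true → f e ≤ g e) → sumOver S f ≤ sumOver S g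
    sumOver-mono-≤ {f} {g} f≤g = sum-mono-≤ λ e → pointwise (lookup S e) (f≤g e)
      where
      pointwise : ∀ b {x y} → (b ≡ true → x ≤ y) → restrict b x ≤ restrict b y
      pointwise true  x≤y = x≤y ≡.refl
      pointwise false _   = ≤-refl

    sumOver-cong : ∀ {f g} → (∀ e → lookup S e ≡ true → f e ≈ g e) → sumOver S f ≈ sumOver S g
    sumOver-cong f≈g = antisym (sumOver-mono-≤ λ e e∈S → ≤-reflexive (f≈g e e∈S))
      (sumOver-mono-≤ λ e e∈S → ≤-reflexive˘ (f≈g e e∈S))

    sumOver-nonNeg : ∀ {f} → (∀ e → 0# ≤ f e) → 0# ≤ sumOver S f
    sumOver-nonNeg 0≤f = sum-nonNeg λ e → restrict-nonNeg (lookup S e) (0≤f e)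

    term≤sumOver : ∀ {f} → (∀ e → 0# ≤ f e) → ∀ e → lookup S e ≡ true → f e ≤ sumOver S f
    term≤sumOver {f} 0≤f e e∈S = ≤-trans
      (≤-reflexive (reflexive (≡.cong (λ b → restrict b (f e)) (≡.sym e∈S))))
      (term≤sum (λ e → restrict-nonNeg (lookup S e) (0≤f e)) e)

    sumOver-+ : ∀ f g → sumOver S (λ e → f e + g e) ≈ sumOver S f + sumOver S g
    sumOver-+ f g = trans (sum-cong-≋ λ e → pointwise (lookup S e))
      (∑-distrib-+ (λ e → restrict (lookup S e) (f e)) (λ e → restrict (lookup S e) (g e)))
      where
      pointwise : ∀ b {x y} → restrict b (x + y) ≈ restrict b x + restrict b y
      pointwise true  = refl
      pointwise false = sym (+-identityʳ 0#)

    sumOver-* : ∀ r f → sumOver S (λ e → r * f e) ≈ r * sumOver S f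
    sumOver-* r f = trans (sum-cong-≋ λ e → pointwise (lookup S e))
      (sym (*-distribˡ-sum r (λ e → restrict (lookup S e) (f e))))
      where
      pointwise : ∀ b {x} → restrict b (r * x) ≈ r * restrict b x
      pointwise true  = refl
      pointwise false = sym (zeroʳ r)

  ∣S∣≈sumOver-1 : ∀ {n} (S : Subset n) → fromℕ ∣ S ∣ ≈ sumOver S (const 1#)
  ∣S∣≈sumOver-1 []          = refl
  ∣S∣≈sumOver-1 (true ∷ S)  = +-congˡ (∣S∣≈sumOver-1 S)
  ∣S∣≈sumOver-1 (false ∷ S) = trans (∣S∣≈sumOver-1 S) (sym (+-identityˡ _))

  sumOver-const : ∀ {n} (S : Subset n) r → sumOver S (const r) ≈ fromℕ ∣ S ∣ * r
  sumOver-const S r = begin-equality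
    sumOver S (const r)         ≈⟨ sumOver-cong S (λ _ _ → sym (*-identityʳ r)) ⟩
    sumOver S (λ _ → r * 1#)    ≈⟨ sumOver-* S r (const 1#) ⟩
    r * sumOver S (const 1#)    ≈⟨ *-congˡ (∣S∣≈sumOver-1 S) ⟨
    r * fromℕ ∣ S ∣             ≈⟨ *-comm _ _ ⟩
    fromℕ ∣ S ∣ * r             ∎

  base≤maxOver : ∀ {n} x (S : Subset n) f → x ≤ maxOver x S f
  base≤maxOver x []      f = ≤-refl
  base≤maxOver x (b ∷ S) f = ≤-trans (base≤maxOver x S (f ∘ suc)) (x≤y⊔x (if b then f zero else x) _)

  term≤maxOver : ∀ {n} x (S : Subset n) f e → lookup S e ≡ true → f e ≤ maxOver x S f
  term≤maxOver x (true ∷ S) f zero    ≡.refl = x≤x⊔y (f zero) _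
  term≤maxOver x (b ∷ S)    f (suc e) e∈S    = ≤-trans (term≤maxOver x S (f ∘ suc) e e∈S)
    (x≤y⊔x (if b then f zero else x) _)

-- A Chernoff bound for inverse-probability estimates of a sum.

module Chernoff {c ℓ} (R : CompleteOrderedField c ℓ) where

  open OrderedField R
  open Exponential R
  open Expectation R
  open SumOver R
  open ≤-Reasoning

  module Tilt (σ θ ε : ℝ) where

    -- The tilting exponent a of an element is σθx / p, except that elements which
    -- are certain to be sampled get a = 0, since their x need not be small.
    record IsTilt (p x : ℝ) (b : Bool) (a : ℝ) : Set (c Level.⊔ ℓ) where
      field
        2a≤1      : fromℕ 2 * a ≤ 1#
        variance  : fromℕ 4 * (p * (a * a)) ≤ ε * (θ * restrict b x)
        centred   : ∀ c → Possible p b c →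
          restrict c a - p * a ≈ σ * θ * (restrict c (x / p) - restrict b x)
        excluded  : b ≡ false → a ≈ 0#

    -- For an element outside the set, or with `p ≈ 1#`, the outcome is determined and `a = 0`
    -- works. Otherwise `h = θx/p` is at most `ε/4`; this gives `2a ≤ 1` for either sign, and
    -- `4pa² = 4h · θx ≤ ε θx`.
    tilt : σ ≈ 1# ⊎ σ ≈ - 1# → 0# ≤ θ → 0# ≤ ε → ε ≤ 1# →
      ∀ {p x} → 0# < p → 0# ≤ x → ∀ b →
      (b ≡ true → p ≈ 1# ⊎ fromℕ 4 * (θ * x) ≤ ε * p) → ∃ (IsTilt p x b)
    tilt σ≈±1 0≤θ 0≤ε ε≤1 {p} {x} 0<p 0≤x false _ = 0# , record
      { 2a≤1     = ≤-trans (≤-reflexive (zeroʳ _)) 0≤1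
      ; variance = ≤-reflexive (solve 3 (λ p ε l → lit 4 :* (p :* (lit 0 :* lit 0)) := ε :* (l :* lit 0)) refl p ε θ)
      ; centred  = λ where
          true  (c⇒b , _) → case c⇒b ≡.refl of λ ()
          false _ → solve 3 (λ p σ l → lit 0 :- p :* lit 0 := σ :* l :* (lit 0 :- lit 0)) refl p σ θ
      ; excluded = λ _ → refl
      }
    tilt σ≈±1 0≤θ 0≤ε ε≤1 {p} {x} 0<p 0≤x true small with small ≡.refl
    ... | inj₁ p≈1 = 0# , record
      { 2a≤1     = ≤-trans (≤-reflexive (zeroʳ _)) 0≤1
      ; variance = ≤-trans (≤-reflexive (solve 1 (λ p → lit 4 :* (p :* (lit 0 :* lit 0)) := lit 0) refl p))
          (*-nonNeg 0≤ε (*-nonNeg 0≤θ 0≤x))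
      ; centred  = λ where
          false (_ , certain) → case certain ≡.refl p≈1 of λ ()
          true _ → begin-equality
            0# - p * 0#              ≈⟨ solve 4 (λ p σ l x → lit 0 :- p :* lit 0 := σ :* l :* (x :* lit 1 :- x)) refl p σ θ x ⟩
            σ * θ * (x * 1# - x)    ≈⟨ *-congˡ (+-congʳ (*-congˡ (x≈1⇒x⁻¹≈1 p≈1))) ⟨
            σ * θ * (x / p - x)     ∎
      ; excluded = λ ()
      }
    ... | inj₂ 4θx≤εp = σ * h , record
      { 2a≤1     = begin
          fromℕ 2 * (σ * h)   ≤⟨ *-monoʳ-≤ (fromℕ-nonNeg 2) (σh≤h σ≈±1) ⟩
          fromℕ 2 * h         ≤⟨ slack (*-nonNeg (fromℕ-nonNeg 2) 0≤h)
                                   (solve 1 (λ h → lit 4 :* h := lit 2 :* h :+ lit 2 :* h) refl h) ⟩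
          fromℕ 4 * h         ≤⟨ 4h≤ε ⟩
          ε                   ≤⟨ ε≤1 ⟩
          1#                  ∎
      ; variance = begin
          fromℕ 4 * (p * (σ * h * (σ * h)))
            ≈⟨ solve 5 (λ p σ l x i → lit 4 :* (p :* (σ :* (l :* x :* i) :* (σ :* (l :* x :* i)))) :=
                 σ :* σ :* (i :* p) :* (lit 4 :* (l :* x :* i) :* (l :* x))) refl p σ θ x (p ⁻¹) ⟩
          σ * σ * (p ⁻¹ * p) * (fromℕ 4 * h * (θ * x))
            ≈⟨ *-congʳ (*-cong (σσ≈1 σ≈±1) p⁻¹p≈1) ⟩
          1# * 1# * (fromℕ 4 * h * (θ * x))
            ≈⟨ trans (*-congʳ (*-identityˡ 1#)) (*-identityˡ _) ⟩
          fromℕ 4 * h * (θ * x)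
            ≤⟨ *-monoˡ-≤ (*-nonNeg 0≤θ 0≤x) 4h≤ε ⟩
          ε * (θ * x) ∎
      ; centred  = λ where
          true _ → begin-equality
            σ * h - p * (σ * h)
              ≈⟨ solve 5 (λ p σ l x i → σ :* (l :* x :* i) :- p :* (σ :* (l :* x :* i)) :=
                   σ :* l :* (x :* i :- x :* (i :* p))) refl p σ θ x (p ⁻¹) ⟩
            σ * θ * (x / p - x * (p ⁻¹ * p))
              ≈⟨ *-congˡ (+-congˡ (-‿cong (trans (*-congˡ p⁻¹p≈1) (*-identityʳ x)))) ⟩
            σ * θ * (x / p - x) ∎
          false _ → begin-equality
            0# - p * (σ * h)
              ≈⟨ solve 5 (λ p σ l x i → lit 0 :- p :* (σ :* (l :* x :* i)) :=
                   σ :* l :* (lit 0 :- x :* (i :* p))) refl p σ θ x (p ⁻¹) ⟩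
            σ * θ * (0# - x * (p ⁻¹ * p))
              ≈⟨ *-congˡ (+-congˡ (-‿cong (trans (*-congˡ p⁻¹p≈1) (*-identityʳ x)))) ⟩
            σ * θ * (0# - x) ∎
      ; excluded = λ ()
      }
      where
      h : ℝ
      h = θ * x / p
      p⁻¹p≈1 : p ⁻¹ * p ≈ 1#
      p⁻¹p≈1 = trans (*-comm _ _) (⁻¹-inverseʳ (<⇒≉0 0<p))
      0≤h : 0# ≤ h
      0≤h = /-nonNeg (*-nonNeg 0≤θ 0≤x) (proj₁ 0<p)
      4h≤ε : fromℕ 4 * h ≤ ε
      4h≤ε = ≤-trans (≤-reflexive˘ (*-assoc _ _ _)) (x≤y*z⇒x/z≤y 0<p 4θx≤εp)
      σh≤h : σ ≈ 1# ⊎ σ ≈ - 1# → σ * h ≤ h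
      σh≤h (inj₁ σ≈1)  = ≤-reflexive (trans (*-congʳ σ≈1) (*-identityˡ h))
      σh≤h (inj₂ σ≈-1) = ≤-trans (≤-reflexive (*-congʳ σ≈-1))
        (slack (*-nonNeg (fromℕ-nonNeg 2) 0≤h) (solve 1 (λ h → h := (:- lit 1) :* h :+ lit 2 :* h) refl h))
      σσ≈1 : σ ≈ 1# ⊎ σ ≈ - 1# → σ * σ ≈ 1#
      σσ≈1 (inj₁ σ≈1)  = trans (*-cong σ≈1 σ≈1) (*-identityˡ 1#)
      σσ≈1 (inj₂ σ≈-1) = trans (*-cong σ≈-1 σ≈-1) (solve 0 ((:- lit 1) :* (:- lit 1) := lit 1) refl)

  -- Moments are controlled by eᵃ ≤ 1 + a + 2a², which holds for a ≤ 1/2.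
  module _ {p a : ℝ} (0<p : 0# < p) (p≤1 : p ≤ 1#) (2a≤1 : fromℕ 2 * a ≤ 1#) where

    private
      u : ℝ
      u = 1# + a + fromℕ 2 * (a * a)

    -- An upper bound for the logarithm of the moment of `eᵃ`:
    -- `1 + p (eᵃ - 1) ≤ 1 + drift ≤ e^drift`.
    drift : ℝ
    drift = p * (a + fromℕ 2 * (a * a))

    1+drift : ℝ
    1+drift = 1# + drift

    -- A polynomial substitute for the tilted density `e^(ca - drift)`, normalised so that its
    -- expectation is exactly 1.
    weight : Bool → ℝ
    weight c = (if c then u else 1#) / 1+drift

    -- Lies between `1 / weight c` and `e^(drift - ca)`, as the two lemmas below show. This is what
    -- bounds `weight c` from below by an exponential without mentioning one.
    damping : Bool → ℝ
    damping c = (1# - restrict c a) * 1+drift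

    private
      0<u : 0# < u
      -- Completing the square, `8u = 7 + (4a + 1)²`.
      0<u = ≰⇒> λ u≤0 → <⇒≱ (fromℕ-pos {7} (ℕ.s≤s ℕ.z≤n)) (begin
        fromℕ 7      ≤⟨ slack (square-nonNeg (fromℕ 4 * a + 1#))
                          (solve 1 (λ a → lit 8 :* (lit 1 :+ a :+ lit 2 :* (a :* a)) :=
                            lit 7 :+ (lit 4 :* a :+ lit 1) :* (lit 4 :* a :+ lit 1)) refl a) ⟩
        fromℕ 8 * u  ≤⟨ *-monoʳ-≤ (fromℕ-nonNeg 8) u≤0 ⟩
        fromℕ 8 * 0# ≈⟨ zeroʳ _ ⟩
        0#           ∎)

    1+drift-pos : 0# < 1+drift
    1+drift-pos = <-≤-trans (*-pos 0<p 0<u) (slack (0≤y-x p≤1)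
      (solve 2 (λ p a → lit 1 :+ p :* (a :+ lit 2 :* (a :* a)) :=
        p :* (lit 1 :+ a :+ lit 2 :* (a :* a)) :+ (lit 1 :- p)) refl p a))

    weight-nonNeg : ∀ c → 0# ≤ weight c
    weight-nonNeg true  = /-nonNeg (proj₁ 0<u) (proj₁ 1+drift-pos)
    weight-nonNeg false = /-nonNeg 0≤1 (proj₁ 1+drift-pos)

    private
      0≤1-restrict : ∀ c → 0# ≤ 1# - restrict c a
      0≤1-restrict true  = *-cancelʳ-≤ {fromℕ 2} (fromℕ-pos {2} (ℕ.s≤s ℕ.z≤n)) (slack
        (+-nonNeg 0≤1 (0≤y-x 2a≤1)) (solve 1 (λ a → (lit 1 :- a) :* lit 2 :=
          lit 0 :* lit 2 :+ (lit 1 :+ (lit 1 :- lit 2 :* a))) refl a))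
      0≤1-restrict false = 0≤y-x 0≤1

    damping-nonNeg : ∀ c → 0# ≤ damping c
    damping-nonNeg c = *-nonNeg (0≤1-restrict c) (proj₁ 1+drift-pos)

    damping*exp≤1 : ∀ c → damping c *exp restrict c a - drift ≤1
    damping*exp≤1 c = *-*exp (0≤1-restrict c) (proj₁ 1+drift-pos) ([1-x]*exp≤1 (restrict c a))
      (*exp-anti (≤-trans (proj₁ 1+drift-pos) (≤-reflexive˘ 1--drift≈)) (≤-reflexive˘ 1--drift≈) ≤-refl
        ([1-x]*exp≤1 (- drift)))
      where
      1--drift≈ : 1# - - drift ≈ 1+drift
      1--drift≈ = solve 1 (λ d → lit 1 :- (:- d) := lit 1 :+ d) refl drift

    -- For a sampled element the point is `(1 - a)(1 + a + 2a²) = 1 + a² (1 - 2a)`, whose last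
    -- summand is nonnegative because `2a ≤ 1`. The factor `1+drift` cancels.
    1≤damping*weight : ∀ c → 1# ≤ damping c * weight c
    1≤damping*weight c = begin
      1#                                ≤⟨ 1≤ c ⟩
      (1# - restrict c a) * v c         ≈⟨ *-identityʳ _ ⟨
      (1# - restrict c a) * v c * 1#    ≈⟨ *-congˡ (⁻¹-inverseʳ (<⇒≉0 1+drift-pos)) ⟨
      (1# - restrict c a) * v c * (1+drift * 1+drift ⁻¹)
        ≈⟨ solve 4 (λ m v g i → m :* v :* (g :* i) := m :* g :* (v :* i)) refl
             (1# - restrict c a) (v c) 1+drift (1+drift ⁻¹) ⟩
      damping c * weight c ∎
      where
      v : Bool → ℝ
      v c = if c then u else 1#
      1≤ : ∀ c → 1# ≤ (1# - restrict c a) * v c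
      1≤ true  = slack (*-nonNeg (square-nonNeg a) (0≤y-x 2a≤1)) (solve 1 (λ a →
        (lit 1 :- a) :* (lit 1 :+ a :+ lit 2 :* (a :* a)) := lit 1 :+ a :* a :* (lit 1 :- lit 2 :* a)) refl a)
      1≤ false = ≤-reflexive (solve 0 (lit 1 := (lit 1 :- lit 0) :* lit 1) refl)

    𝔼-weight-bernoulli : 𝔼 (bernoulli p) weight ≈ 1#
    𝔼-weight-bernoulli = begin-equality
      𝔼 (bernoulli p) weight
        ≈⟨ 𝔼-bernoulli p weight ⟩
      p * (u / 1+drift) + (1# - p) * (1# / 1+drift)
        ≈⟨ solve 3 (λ p a i → p :* ((lit 1 :+ a :+ lit 2 :* (a :* a)) :* i) :+ (lit 1 :- p) :* (lit 1 :* i) :=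
             (lit 1 :+ p :* (a :+ lit 2 :* (a :* a))) :* i) refl p a (1+drift ⁻¹) ⟩
      1+drift * 1+drift ⁻¹
        ≈⟨ ⁻¹-inverseʳ (<⇒≉0 1+drift-pos) ⟩
      1# ∎

    𝔼-weight-false : a ≈ 0# → 𝔼 (return false) weight ≈ 1#
    𝔼-weight-false a≈0 = trans (𝔼-return false weight) (trans (*-identityˡ _)
      (x≈1⇒x⁻¹≈1 (begin-equality
        1# + p * (a + fromℕ 2 * (a * a))    ≈⟨ +-congˡ (*-congˡ (+-cong a≈0 (*-congˡ (*-cong a≈0 a≈0)))) ⟩
        1# + p * (0# + fromℕ 2 * (0# * 0#)) ≈⟨ solve 1 (λ p → lit 1 :+ p :* (lit 0 :+ lit 2 :* (lit 0 :* lit 0)) := lit 1) refl p ⟩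
        1#                                  ∎)))

  module _ {n} (S : Subset n) (p x : Fin n → ℝ) (ε T y : ℝ)
    (0≤x : ∀ e → 0# ≤ x e) (0<p : ∀ e → 0# < p e) (p≤1 : ∀ e → p e ≤ 1#)
    (0<T : 0# < T) (0<ε : 0# < ε) (ε≤1 : ε ≤ 1#) (1≤y : 1# ≤ y)
    (72ln≤ε²T : fromℕ 72 * ln y ≤ ε * ε * T)
    (balanced : ∀ e → lookup S e ≡ true → p e ≈ 1# ⊎ T * x e ≤ fromℕ 9 * sumOver S x * p e)
    where

    private
      W : ℝ
      W = sumOver S x

      Ŵ : Subset n → ℝ
      Ŵ F = sumOver F (λ e → x e / p e)

    -- Markov's inequality for the product of the weights, which has expectation 1 and is at least
    -- `y` whenever the estimate deviates. The sign `σ` selects the upper or the lower tail.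
    one-sided-tail : (σ : ℝ) → σ ≈ 1# ⊎ σ ≈ - 1# → 0# < W →
      y * 𝔼 (randomSubset S p) (λ F → 𝟙 (ε * W ≤? σ * (Ŵ F - W))) ≤ 1#
    one-sided-tail σ σ≈±1 0<W = ≤-trans
      (markov (λ F → ε * W ≤? σ * (Ŵ F - W)) q y (≤-trans 0≤1 1≤y)
        (λ e → supported e) (λ e → weight-nonNeg (0<p e) (p≤1 e) (2a≤1 e)) y≤product)
      (product-≤1 (λ e → ≤-trans 0≤1 (≤-reflexive˘ (𝔼q≈1 e))) (λ e → ≤-reflexive (𝔼q≈1 e)))
      where
      θ : ℝ
      -- Chosen so that `T x ≤ 9 W p` from `balanced` becomes the smallness condition `4θx ≤ εp` of
      -- `tilt`.
      θ = ε * T / (fromℕ 36 * W)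
      0<36W : 0# < fromℕ 36 * W
      0<36W = *-pos (fromℕ-pos {36} (ℕ.s≤s ℕ.z≤n)) 0<W
      θ*36W≈εT : θ * (fromℕ 36 * W) ≈ ε * T
      θ*36W≈εT = /-*-cancel (ε * T) (<⇒≉0 0<36W)
      0≤θ : 0# ≤ θ
      0≤θ = /-nonNeg (*-nonNeg (proj₁ 0<ε) (proj₁ 0<T)) (proj₁ 0<36W)
      small : ∀ e → lookup S e ≡ true → p e ≈ 1# ⊎ fromℕ 4 * (θ * x e) ≤ ε * p e
      small e e∈S with balanced e e∈S
      ... | inj₁ p≈1 = inj₁ p≈1
      ... | inj₂ Tx≤9Wp = inj₂ (*-cancelʳ-≤ 0<36W (begin
        fromℕ 4 * (θ * x e) * (fromℕ 36 * W)
          ≈⟨ solve 3 (λ l x w → lit 4 :* (l :* x) :* w := lit 4 :* x :* (l :* w)) refl θ (x e) (fromℕ 36 * W) ⟩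
        fromℕ 4 * x e * (θ * (fromℕ 36 * W))
          ≈⟨ *-congˡ θ*36W≈εT ⟩
        fromℕ 4 * x e * (ε * T)
          ≈⟨ solve 3 (λ x ε T → lit 4 :* x :* (ε :* T) := lit 4 :* ε :* (T :* x)) refl (x e) ε T ⟩
        fromℕ 4 * ε * (T * x e)
          ≤⟨ *-monoʳ-≤ (*-nonNeg (fromℕ-nonNeg 4) (proj₁ 0<ε)) Tx≤9Wp ⟩
        fromℕ 4 * ε * (fromℕ 9 * W * p e)
          ≈⟨ solve 3 (λ ε W p → lit 4 :* ε :* (lit 9 :* W :* p) := ε :* p :* (lit 36 :* W)) refl ε W (p e) ⟩
        ε * p e * (fromℕ 36 * W) ∎))
      open Tilt σ θ ε
      tilts : ∀ e → ∃ (IsTilt (p e) (x e) (lookup S e))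
      tilts e = tilt σ≈±1 0≤θ (proj₁ 0<ε) ε≤1 (0<p e) (0≤x e) (lookup S e) (small e)
      a : Fin n → ℝ
      a e = proj₁ (tilts e)
      open module T e = IsTilt (proj₂ (tilts e))
      q d : Fin n → Bool → ℝ
      q e = weight (0<p e) (p≤1 e) (2a≤1 e)
      d e = damping (0<p e) (p≤1 e) (2a≤1 e)
      g : Fin n → ℝ
      g e = drift (0<p e) (p≤1 e) (2a≤1 e)
      supported : ∀ e → Supported (Possible (p e) (lookup S e)) (inclusion S p e)
      supported = Supported-inclusion S p (λ e → proj₁ (0<p e)) p≤1
      𝔼q≈1 : ∀ e → 𝔼 (inclusion S p e) (q e) ≈ 1#
      𝔼q≈1 e = by-cases (lookup S e) (excluded e)
        where
        by-cases : ∀ b → (b ≡ false → a e ≈ 0#) → 𝔼 (if b then bernoulli (p e) else return false) (q e) ≈ 1#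
        by-cases true  _        = 𝔼-weight-bernoulli (0<p e) (p≤1 e) (2a≤1 e)
        by-cases false excluded = 𝔼-weight-false (0<p e) (p≤1 e) (2a≤1 e) (excluded ≡.refl)
      -- With `D` the product of the dampings and `Q` that of the weights, `1 ≤ D * Q`. Moreover
      -- `D * y ≤ 1`, since `D` times the exponential of the summed exponents is at most 1 and that
      -- sum is at least `ln y`. Hence `y ≤ y D Q ≤ Q`.
      y≤product : ∀ F → IsSample S p F → ε * W ≤ σ * (Ŵ F - W) → y ≤ product (λ e → q e (lookup F e))
      y≤product F sample deviates = begin
        y
          ≈⟨ *-identityʳ y ⟨
        y * 1#
          ≤⟨ *-monoʳ-≤ (≤-trans 0≤1 1≤y) (1≤product (λ e →
               1≤damping*weight (0<p e) (p≤1 e) (2a≤1 e) (lookup F e))) ⟩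
        y * product (λ e → d e (lookup F e) * q e (lookup F e))
          ≈⟨ *-congˡ (product-* (λ e → d e (lookup F e)) (λ e → q e (lookup F e))) ⟩
        y * (D * Q)
          ≈⟨ solve 3 (λ y D Q → y :* (D :* Q) := D :* y :* Q) refl y D Q ⟩
        D * y * Q
          ≤⟨ *-monoˡ-≤ (product-nonNeg (λ e → weight-nonNeg (0<p e) (p≤1 e) (2a≤1 e) (lookup F e)))
               (*exp≤1⇒*≤1 (product-nonNeg 0≤d) 1≤y (product-*exp 0≤d (λ e →
                 damping*exp≤1 (0<p e) (p≤1 e) (2a≤1 e) (lookup F e))) ln≤exponent) ⟩
        1# * Q
          ≈⟨ *-identityˡ Q ⟩
        Q ∎
        where
        D Q : ℝ
        D = product (λ e → d e (lookup F e))
        Q = product (λ e → q e (lookup F e))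
        0≤d : ∀ e → 0# ≤ d e (lookup F e)
        0≤d e = damping-nonNeg (0<p e) (p≤1 e) (2a≤1 e) (lookup F e)
        exponent ŵ w : Fin n → ℝ
        exponent e = restrict (lookup F e) (a e) - g e
        ŵ e = restrict (lookup F e) (x e / p e)
        w e = restrict (lookup S e) (x e)
        α β : ℝ
        α = fromℕ 2 * (σ * θ)
        β = - (α + ε * θ)
        -- Doubling the exponent turns the second-order part `2pa²` of the drift into `4pa²`, which
        -- `variance` bounds by `εθ` times the true summand. The rest is the centred deviation,
        -- linear in the estimate.
        termwise : ∀ e → α * ŵ e + β * w e ≤ fromℕ 2 * exponent e
        termwise e = begin
          α * ŵ e + β * w e
            ≈⟨ solve 4 (λ s v w el → lit 2 :* s :* v :+ (:- (lit 2 :* s :+ el)) :* w :=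
                 lit 2 :* (s :* (v :- w)) :- el :* w) refl (σ * θ) (ŵ e) (w e) (ε * θ) ⟩
          fromℕ 2 * (σ * θ * (ŵ e - w e)) - ε * θ * w e
            ≤⟨ +-mono-≤ (≤-reflexive˘ (*-congˡ (centred e (lookup F e) (sample e))))
                 (-‿anti-≤ (≤-trans (variance e) (≤-reflexive˘ (*-assoc _ _ _)))) ⟩
          fromℕ 2 * (restrict (lookup F e) (a e) - p e * a e) - fromℕ 4 * (p e * (a e * a e))
            ≈⟨ solve 3 (λ r p a → lit 2 :* (r :- p :* a) :- lit 4 :* (p :* (a :* a)) :=
                 lit 2 :* (r :- p :* (a :+ lit 2 :* (a :* a)))) refl (restrict (lookup F e) (a e)) (p e) (a e) ⟩
          fromℕ 2 * exponent e ∎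
        -- Summed up, twice the exponent is at least `2θ σ(Ŵ - W) - εθW`. A deviation of `εW` makes
        -- this at least `εθW = ε²T/36`, so the exponent itself reaches `ε²T/72`.
        ln≤exponent : ln y ≤ sum exponent
        ln≤exponent = *-cancelʳ-≤ {fromℕ 72} (fromℕ-pos {72} (ℕ.s≤s ℕ.z≤n)) (begin
          ln y * fromℕ 72
            ≈⟨ *-comm _ _ ⟩
          fromℕ 72 * ln y
            ≤⟨ 72ln≤ε²T ⟩
          ε * ε * T
            ≈⟨ *-assoc ε ε T ⟩
          ε * (ε * T)
            ≈⟨ *-congˡ θ*36W≈εT ⟨
          ε * (θ * (fromℕ 36 * W))
            ≤⟨ slack (*-nonNeg (*-nonNeg (fromℕ-nonNeg 72) 0≤θ) (0≤y-x deviates))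
                 (solve 5 (λ ε l s V W →
                   lit 36 :* (lit 2 :* (s :* l) :* V :+ (:- (lit 2 :* (s :* l) :+ ε :* l)) :* W) :=
                   ε :* (l :* (lit 36 :* W)) :+ lit 72 :* l :* (s :* (V :- W) :- ε :* W))
                   refl ε θ σ (Ŵ F) W) ⟩
          fromℕ 36 * (α * Ŵ F + β * W)
            ≈⟨ *-congˡ (+-cong (*-distribˡ-sum α ŵ) (*-distribˡ-sum β w)) ⟩
          fromℕ 36 * (sum (λ e → α * ŵ e) + sum (λ e → β * w e))
            ≈⟨ *-congˡ (∑-distrib-+ (λ e → α * ŵ e) (λ e → β * w e)) ⟨
          fromℕ 36 * sum (λ e → α * ŵ e + β * w e)
            ≤⟨ *-monoʳ-≤ (fromℕ-nonNeg 36) (sum-mono-≤ termwise) ⟩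
          fromℕ 36 * sum (λ e → fromℕ 2 * exponent e)
            ≈⟨ *-congˡ (*-distribˡ-sum (fromℕ 2) exponent) ⟨
          fromℕ 36 * (fromℕ 2 * sum exponent)
            ≈⟨ solve 1 (λ s → lit 36 :* (lit 2 :* s) := s :* lit 72) refl (sum exponent) ⟩
          sum exponent * fromℕ 72 ∎)

    two-sided-tail :
      y * 𝔼 (randomSubset S p) (λ F → 𝟙 (¬? (∣ Ŵ F - W ∣ᵣ ≤? ε * W))) ≤ fromℕ 2
    two-sided-tail with W ≤? 0#
    ... | no W≰0 = begin
      y * 𝔼 μ (λ F → 𝟙 (¬? (∣ Ŵ F - W ∣ᵣ ≤? ε * W)))
        ≤⟨ *-monoʳ-≤ (≤-trans 0≤1 1≤y) (𝔼-mono-≤ (Supported-randomSubset S p (λ e → proj₁ (0<p e)) p≤1)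
             (λ F _ → either F)) ⟩
      y * 𝔼 μ (λ F → 𝟙 (ε * W ≤? 1# * (Ŵ F - W)) + 𝟙 (ε * W ≤? - 1# * (Ŵ F - W)))
        ≈⟨ trans (*-congˡ (𝔼-+ μ _ _)) (distribˡ y _ _) ⟩
      y * 𝔼 μ (λ F → 𝟙 (ε * W ≤? 1# * (Ŵ F - W))) + y * 𝔼 μ (λ F → 𝟙 (ε * W ≤? - 1# * (Ŵ F - W)))
        ≤⟨ +-mono-≤ (one-sided-tail 1# (inj₁ refl) (≰⇒> W≰0)) (one-sided-tail (- 1#) (inj₂ refl) (≰⇒> W≰0)) ⟩
      1# + 1#
        ≈⟨ +-congˡ (+-identityʳ 1#) ⟨
      fromℕ 2 ∎
      where
      μ = randomSubset S p
      either : ∀ F → 𝟙 (¬? (∣ Ŵ F - W ∣ᵣ ≤? ε * W)) ≤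
        𝟙 (ε * W ≤? 1# * (Ŵ F - W)) + 𝟙 (ε * W ≤? - 1# * (Ŵ F - W))
      either F = 𝟙≤ (¬? (∣ Ŵ F - W ∣ᵣ ≤? ε * W)) (+-nonNeg 0≤₁ 0≤₂) λ deviates →
        case total (ε * W) (Ŵ F - W) of λ where
          (inj₁ εW≤D) → slack 0≤₂ (+-congʳ (𝟙-true (ε * W ≤? 1# * (Ŵ F - W))
            (≤-trans εW≤D (≤-reflexive˘ (*-identityˡ _)))))
          (inj₂ D≤εW) → case total (ε * W) (- (Ŵ F - W)) of λ where
            (inj₁ εW≤-D) → slack 0≤₁ (trans (+-comm _ _) (+-congʳ (𝟙-true (ε * W ≤? - 1# * (Ŵ F - W))
              (≤-trans εW≤-D (≤-reflexive (solve 1 (λ z → :- z := (:- lit 1) :* z) refl (Ŵ F - W)))))))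
            (inj₂ -D≤εW) → contradiction (∣x∣≤y D≤εW -D≤εW) deviates
        where
        0≤₁ = 𝟙-nonNeg (ε * W ≤? 1# * (Ŵ F - W))
        0≤₂ = 𝟙-nonNeg (ε * W ≤? - 1# * (Ŵ F - W))
    -- The rate `θ` divides by `W`, so `W ≈ 0#` is treated apart: all summands over the set vanish,
    -- and every possible sample gives the exact value 0.
    ... | yes W≤0 = begin
      y * 𝔼 μ (λ F → 𝟙 (¬? (∣ Ŵ F - W ∣ᵣ ≤? ε * W)))
        ≤⟨ *-monoʳ-≤ (≤-trans 0≤1 1≤y) (𝔼-mono-≤ (Supported-randomSubset S p (λ e → proj₁ (0<p e)) p≤1)
             (λ F sample → 𝟙≤ (¬? (∣ Ŵ F - W ∣ᵣ ≤? ε * W)) ≤-refl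
               (λ deviates → contradiction (exact F sample) deviates))) ⟩
      y * 𝔼 μ (const 0#)
        ≈⟨ trans (*-congˡ (𝔼-0 μ)) (zeroʳ y) ⟩
      0#
        ≤⟨ fromℕ-nonNeg 2 ⟩
      fromℕ 2 ∎
      where
      μ = randomSubset S p
      0≤w : ∀ e → 0# ≤ restrict (lookup S e) (x e)
      0≤w e = restrict-nonNeg (lookup S e) (0≤x e)
      W≈0 : W ≈ 0#
      W≈0 = antisym W≤0 (sum-nonNeg 0≤w)
      ŵ≈0 : ∀ {p x} b c → restrict b x ≈ 0# → Possible p b c → restrict c (x / p) ≈ 0#
      ŵ≈0 b false _ _ = refl
      ŵ≈0 b true w≈0 (c⇒b , _) with c⇒b ≡.refl
      ŵ≈0 .true true w≈0 _ | ≡.refl = trans (*-congʳ w≈0) (zeroˡ _)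
      exact : ∀ F → IsSample S p F → ∣ Ŵ F - W ∣ᵣ ≤ ε * W
      exact F sample = ∣x∣≤y (≤-reflexive (trans D≈0 (sym εW≈0)))
        (≤-reflexive (trans (-‿cong D≈0) (trans -0#≈0# (sym εW≈0))))
        where
        εW≈0 : ε * W ≈ 0#
        εW≈0 = trans (*-congˡ W≈0) (zeroʳ ε)
        Ŵ≈0 : Ŵ F ≈ 0#
        Ŵ≈0 = trans (sum-cong-≋ (λ e → ŵ≈0 (lookup S e) (lookup F e)
          (antisym (≤-trans (term≤sum 0≤w e) W≤0) (0≤w e)) (sample e))) (sum-replicate-zero n)
        D≈0 : Ŵ F - W ≈ 0#
        D≈0 = trans (+-cong Ŵ≈0 (-‿cong W≈0)) (-‿inverseʳ 0#)

-- Pivots and sampling within one cluster.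

module ClusterSampling {c ℓ} (R : CompleteOrderedField c ℓ) where

  open OrderedField R

  module FromSubset {n} (S : Subset n) (dist : Fin n → Fin n → ℝ)
    (dist-nonNeg : ∀ e e′ → 0# ≤ dist e e′) (dist-sym : ∀ e e′ → dist e e′ ≈ dist e′ e)
    (dist-triangle : ∀ e e′ e″ → dist e e″ ≤ dist e e′ + dist e′ e″) (0<∣S∣ : 0 ℕ.< ∣ S ∣)
    where

    open Exponential R
    open Expectation R
    open Chernoff R
    open SumOver R
    open ≤-Reasoning

    m : ℝ
    m = fromℕ ∣ S ∣

    0<m : 0# < m
    0<m = fromℕ-pos 0<∣S∣

    W : Fin n → ℝ
    W e = sumOver S (dist e)

    W-nonNeg : ∀ e → 0# ≤ W e
    W-nonNeg e = sumOver-nonNeg S (dist-nonNeg e)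

    total-W : ℝ
    total-W = sumOver S W

    -- Good pivots are about as central as an average element, whence by
    -- Markov's inequality at least half of the elements are good.
    GoodPivot : Pred (Fin n) ℓ
    GoodPivot ē = m * W ē ≤ fromℕ 2 * total-W

    goodPivot? : Decidable GoodPivot
    goodPivot? ē = m * W ē ≤? fromℕ 2 * total-W

    -- Each distance within the set is routed through `v`. As `v` may lie outside the set, the bound
    -- also serves estimates made from elements of other clusters.
    total-W≤2mW : ∀ v → total-W ≤ fromℕ 2 * (m * W v)
    total-W≤2mW v = begin
      sumOver S W
        ≤⟨ sumOver-mono-≤ S (λ x _ → sumOver-mono-≤ S λ y _ → dist-triangle x v y) ⟩
      sumOver S (λ x → sumOver S (λ y → dist x v + dist v y))
        ≈⟨ sumOver-cong S (λ x _ → trans (sumOver-+ S (const (dist x v)) (dist v))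
             (+-congʳ (trans (sumOver-const S (dist x v)) (*-congˡ (dist-sym x v))))) ⟩
      sumOver S (λ x → m * dist v x + W v)
        ≈⟨ trans (sumOver-+ S (λ x → m * dist v x) (const (W v)))
             (+-cong (sumOver-* S m (dist v)) (sumOver-const S (W v))) ⟩
      m * W v + m * W v
        ≈⟨ solve 1 (λ x → x :+ x := lit 2 :* x) refl (m * W v) ⟩
      fromℕ 2 * (m * W v) ∎

    W-goodPivot : ∀ {ē} → GoodPivot ē → ∀ v → W ē ≤ fromℕ 4 * W v
    W-goodPivot {ē} good v = *-cancelʳ-≤ 0<m (begin
      W ē * m                           ≈⟨ *-comm _ _ ⟩
      m * W ē                           ≤⟨ good ⟩
      fromℕ 2 * total-W                 ≤⟨ *-monoʳ-≤ (fromℕ-nonNeg 2) (total-W≤2mW v) ⟩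
      fromℕ 2 * (fromℕ 2 * (m * W v))   ≈⟨ solve 2 (λ m w → lit 2 :* (lit 2 :* (m :* w)) := lit 4 :* w :* m) refl m (W v) ⟩
      fromℕ 4 * W v * m                 ∎)

    m*dist≤W+W : ∀ v ē → m * dist v ē ≤ W v + W ē
    m*dist≤W+W v ē = begin
      m * dist v ē                              ≈⟨ sumOver-const S (dist v ē) ⟨
      sumOver S (const (dist v ē))              ≤⟨ sumOver-mono-≤ S (λ x _ → ≤-trans (dist-triangle v x ē)
                                                     (≤-reflexive (+-congˡ (dist-sym x ē)))) ⟩
      sumOver S (λ x → dist v x + dist ē x)     ≈⟨ sumOver-+ S (dist v) (dist ē) ⟩
      W v + W ē                                 ∎

    γ : Subset n → Fin n → ℝ
    γ F⁰ e = maxOver (1# / m) F⁰ (λ ē → dist e ē / W ē)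

    1≤γ*m : ∀ F⁰ e → 1# ≤ γ F⁰ e * m
    1≤γ*m F⁰ e = ≤-trans (≤-reflexive˘ (/-*-cancel 1# (<⇒≉0 0<m)))
      (*-monoˡ-≤ (proj₁ 0<m) (base≤maxOver (1# / m) F⁰ _))

    γ-pos : ∀ F⁰ e → 0# < γ F⁰ e
    γ-pos F⁰ e = <-≤-trans (*-pos 0<1 (⁻¹-pos 0<m)) (base≤maxOver (1# / m) F⁰ _)

    Hit : Pred (Subset n) ℓ
    Hit F⁰ = ∃ λ ē → lookup F⁰ ē ≡ true × lookup S ē ≡ true × GoodPivot ē

    hit? : Decidable Hit
    hit? F⁰ = Fin.any? λ ē → (lookup F⁰ ē Bool.≟ true) ×-dec (lookup S ē Bool.≟ true) ×-dec goodPivot? ē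

    -- This is the pivot term in the maximum `γ`. If `W ē` vanishes, that term is 0 by the division
    -- convention, but so is the distance, being a summand of `W ē`.
    dist≤γ*W : ∀ F⁰ e ē → lookup F⁰ ē ≡ true → lookup S e ≡ true → dist ē e ≤ γ F⁰ e * W ē
    dist≤γ*W F⁰ e ē ē∈F⁰ e∈S with W ē ≤? 0#
    ... | yes W≤0 = begin
      dist ē e       ≤⟨ term≤sumOver S (dist-nonNeg ē) e e∈S ⟩
      W ē            ≤⟨ W≤0 ⟩
      0#             ≤⟨ *-nonNeg (proj₁ (γ-pos F⁰ e)) (W-nonNeg ē) ⟩
      γ F⁰ e * W ē   ∎
    ... | no W≰0 = begin
      dist ē e               ≈⟨ dist-sym ē e ⟩
      dist e ē               ≈⟨ /-*-cancel (dist e ē) (<⇒≉0 (≰⇒> W≰0)) ⟨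
      dist e ē / W ē * W ē   ≤⟨ *-monoˡ-≤ (W-nonNeg ē) (term≤maxOver (1# / m) F⁰ (λ ē → dist e ē / W ē) ē ē∈F⁰) ⟩
      γ F⁰ e * W ē           ∎

    -- Go from `v` to `e` through the pivot. The leg to `ē` is at most `(W v + W ē)/m ≤ 5 W v / m`,
    -- and the base value `1/m` of `γ` absorbs the division by `m`. The leg from `ē` is at most
    -- `γ W ē ≤ 4 γ W v`.
    dist≤9γW : ∀ {F⁰} → Hit F⁰ → ∀ v e → lookup S e ≡ true → dist v e ≤ fromℕ 9 * (γ F⁰ e * W v)
    dist≤9γW {F⁰} (ē , ē∈F⁰ , _ , good) v e e∈S = begin
      dist v e
        ≤⟨ dist-triangle v ē e ⟩
      dist v ē + dist ē e
        ≤⟨ +-mono-≤ dist[v,ē]≤ (≤-trans (dist≤γ*W F⁰ e ē ē∈F⁰ e∈S) (*-monoʳ-≤ 0≤γ (W-goodPivot good v))) ⟩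
      g * (fromℕ 5 * W v) + g * (fromℕ 4 * W v)
        ≈⟨ solve 2 (λ g w → g :* (lit 5 :* w) :+ g :* (lit 4 :* w) := lit 9 :* (g :* w)) refl g (W v) ⟩
      fromℕ 9 * (g * W v) ∎
      where
      g : ℝ
      g = γ F⁰ e
      0≤γ : 0# ≤ g
      0≤γ = proj₁ (γ-pos F⁰ e)
      dist[v,ē]≤ : dist v ē ≤ g * (fromℕ 5 * W v)
      dist[v,ē]≤ = begin
        dist v ē                   ≈⟨ *-identityˡ _ ⟨
        1# * dist v ē              ≤⟨ *-monoˡ-≤ (dist-nonNeg v ē) (1≤γ*m F⁰ e) ⟩
        g * m * dist v ē           ≈⟨ *-assoc _ _ _ ⟩
        g * (m * dist v ē)         ≤⟨ *-monoʳ-≤ 0≤γ (m*dist≤W+W v ē) ⟩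
        g * (W v + W ē)            ≤⟨ *-monoʳ-≤ 0≤γ (+-monoʳ-≤ (W v) (W-goodPivot good v)) ⟩
        g * (W v + fromℕ 4 * W v)  ≈⟨ *-congˡ (solve 1 (λ w → w :+ lit 4 :* w := lit 5 :* w) refl (W v)) ⟩
        g * (fromℕ 5 * W v)        ∎

    good : Fin n → ℝ
    good e = 𝟙 (goodPivot? e)

    -- A bad element has `m W e ≥ 2 total-W`, while these values sum to `m * total-W` over the set,
    -- so at most `m/2` elements are bad. Cancelling `total-W` requires it to be nonzero; if it is
    -- zero, every element of the set is good.
    m≤2∑good : m ≤ fromℕ 2 * sumOver S good
    m≤2∑good with total-W ≤? 0#
    ... | yes T≤0 = begin
      m                                 ≈⟨ trans (sumOver-const S 1#) (*-identityʳ m) ⟨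
      sumOver S (const 1#)              ≈⟨ sumOver-cong S (λ e e∈S → sym (𝟙-true (goodPivot? e) (all-good e e∈S))) ⟩
      sumOver S good                    ≤⟨ slack (sumOver-nonNeg S (λ e → 𝟙-nonNeg (goodPivot? e)))
                                             (solve 1 (λ x → lit 2 :* x := x :+ x) refl (sumOver S good)) ⟩
      fromℕ 2 * sumOver S good          ∎
      where
      all-good : ∀ e → lookup S e ≡ true → GoodPivot e
      all-good e e∈S = begin
        m * W e           ≤⟨ *-monoʳ-≤ (proj₁ 0<m) (term≤sumOver S W-nonNeg e e∈S) ⟩
        m * total-W       ≤⟨ *-monoʳ-≤ (proj₁ 0<m) T≤0 ⟩
        m * 0#            ≈⟨ zeroʳ m ⟩
        0#                ≤⟨ *-nonNeg (fromℕ-nonNeg 2) (sumOver-nonNeg S W-nonNeg) ⟩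
        fromℕ 2 * total-W ∎
    ... | no T≰0 = slack (0≤y-x 2[m-g]≤m)
      (solve 2 (λ m g → lit 2 :* g := m :+ (m :- lit 2 :* (m :- g))) refl m (sumOver S good))
      where
      T : ℝ
      T = total-W
      termwise : ∀ e → fromℕ 2 * T * (1# + - 1# * good e) ≤ m * W e
      termwise e with goodPivot? e
      ... | yes _ = ≤-trans (≤-reflexive (solve 1 (λ T → lit 2 :* T :* (lit 1 :+ (:- lit 1) :* lit 1) := lit 0) refl T))
        (*-nonNeg (proj₁ 0<m) (W-nonNeg e))
      ... | no bad = ≤-trans (≤-reflexive (solve 1 (λ T → lit 2 :* T :* (lit 1 :+ (:- lit 1) :* lit 0) := lit 2 :* T) refl T))
        (≰⇒≥ bad)
      2[m-g]≤m : fromℕ 2 * (m - sumOver S good) ≤ m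
      2[m-g]≤m = *-cancelʳ-≤ (≰⇒> T≰0) (begin
        fromℕ 2 * (m - sumOver S good) * T
          ≈⟨ solve 3 (λ m g T → lit 2 :* (m :- g) :* T := lit 2 :* T :* (m :* lit 1 :+ (:- lit 1) :* g)) refl m (sumOver S good) T ⟩
        fromℕ 2 * T * (m * 1# + - 1# * sumOver S good)
          ≈⟨ *-congˡ (+-cong (sumOver-const S 1#) (sumOver-* S (- 1#) good)) ⟨
        fromℕ 2 * T * (sumOver S (const 1#) + sumOver S (λ e → - 1# * good e))
          ≈⟨ *-congˡ (sumOver-+ S (const 1#) (λ e → - 1# * good e)) ⟨
        fromℕ 2 * T * sumOver S (λ e → 1# + - 1# * good e)
          ≈⟨ sumOver-* S (fromℕ 2 * T) _ ⟨
        sumOver S (λ e → fromℕ 2 * T * (1# + - 1# * good e))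
          ≤⟨ sumOver-mono-≤ S (λ e _ → termwise e) ⟩
        sumOver S (λ e → m * W e)
          ≈⟨ sumOver-* S m W ⟩
        m * T ∎)

    module _ {y} (1≤y : 1# ≤ y) where

      private
        L p⁰ : ℝ
        L  = fromℕ 2 / m * ln y
        p⁰ = 1# ⊓ L

        0≤L : 0# ≤ L
        0≤L = *-nonNeg (/-nonNeg (fromℕ-nonNeg 2) (proj₁ 0<m)) (ln-nonNeg 1≤y)

      0≤p⁰ : 0# ≤ p⁰
      0≤p⁰ = ⊓-glb 0≤1 0≤L

      p⁰≤1 : p⁰ ≤ 1#
      p⁰≤1 = x⊓y≤x 1# L

      private
        h : Fin n → ℝ
        h e = restrict (lookup S e) (good e)

        1-p⁰h : Fin n → ℝ
        1-p⁰h e = 1# - p⁰ * h e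

        -- Vanishes exactly when a good pivot of the set is drawn, so the product over all elements
        -- is the indicator of a miss.
        pivot-avoided : Fin n → Bool → ℝ
        pivot-avoided e c = 1# - restrict c (h e)

        0≤h≤1 : ∀ e → 0# ≤ h e × h e ≤ 1#
        0≤h≤1 e with lookup S e
        ... | true  = 𝟙-nonNeg (goodPivot? e) , 𝟙≤1 (goodPivot? e)
        ... | false = ≤-refl , 0≤1

        𝔼-pivot-avoided : ∀ e → 𝔼 (inclusion S (const p⁰) e) (pivot-avoided e) ≈ 1-p⁰h e
        𝔼-pivot-avoided e with lookup S e
        ... | true  = trans (𝔼-bernoulli p⁰ (λ c → 1# - restrict c (good e))) (solve 2 (λ p x →
          p :* (lit 1 :- x) :+ (lit 1 :- p) :* (lit 1 :- lit 0) := lit 1 :- p :* x) refl p⁰ (good e))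
        ... | false = trans (𝔼-return false (λ c → 1# - restrict c 0#))
          (solve 1 (λ p → lit 1 :- lit 0 := lit 1 :- p :* lit 0) refl p⁰)

        1-p⁰h-nonNeg : ∀ e → 0# ≤ 1-p⁰h e
        1-p⁰h-nonNeg e = 0≤y-x (≤-trans (*-mono-≤ (proj₁ (0≤h≤1 e)) 0≤1 p⁰≤1 (proj₂ (0≤h≤1 e)))
          (≤-reflexive (*-identityˡ 1#)))

        [1-p⁰0]*exp≤1 : 1# - p⁰ * 0# *exp L * 0# ≤1
        [1-p⁰0]*exp≤1 = *exp-anti 0≤1 (≤-reflexive (solve 1 (λ p → lit 1 :- p :* lit 0 := lit 1) refl p⁰))
          (≤-reflexive (zeroʳ L)) 1*exp0≤1

        -- If p⁰ is capped at 1, the factor 1-p⁰h of a good pivot vanishes.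
        [1-p⁰h]*exp≤1 : ∀ e → 1-p⁰h e *exp L * h e ≤1
        [1-p⁰h]*exp≤1 e with lookup S e | goodPivot? e
        ... | false | _     = [1-p⁰0]*exp≤1
        ... | true  | no _  = [1-p⁰0]*exp≤1
        ... | true  | yes _ with ⊓-sel 1# L
        ...   | inj₁ p⁰≈1 = 0*exp≤1 (L * 1#)
          (trans (+-congˡ (-‿cong (trans (*-identityʳ p⁰) p⁰≈1))) (-‿inverseʳ 1#))
        ...   | inj₂ p⁰≈L = *exp-anti 0≤1-L (≤-reflexive 1-p⁰1≈1-L) (≤-reflexive (*-identityʳ L)) ([1-x]*exp≤1 L)
          where
          1-p⁰1≈1-L : 1# - p⁰ * 1# ≈ 1# - L
          1-p⁰1≈1-L = +-congˡ (-‿cong (trans (*-identityʳ p⁰) p⁰≈L))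
          0≤1-L : 0# ≤ 1# - L
          0≤1-L = 0≤y-x (≤-trans (≤-reflexive˘ p⁰≈L) p⁰≤1)

        ln≤∑Lh : ln y ≤ sum (λ e → L * h e)
        ln≤∑Lh = begin
          ln y
            ≈⟨ trans (*-identityʳ _) (*-identityˡ _) ⟨
          1# * ln y * 1#
            ≈⟨ *-congʳ (*-congʳ (⁻¹-inverseʳ (<⇒≉0 0<m))) ⟨
          m * m ⁻¹ * ln y * 1#
            ≈⟨ solve 3 (λ m i l → m :* i :* l :* lit 1 := m :* (i :* l)) refl m (m ⁻¹) (ln y) ⟩
          m * (m ⁻¹ * ln y)
            ≤⟨ *-monoˡ-≤ (*-nonNeg (⁻¹-nonNeg (proj₁ 0<m)) (ln-nonNeg 1≤y)) m≤2∑good ⟩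
          fromℕ 2 * sumOver S good * (m ⁻¹ * ln y)
            ≈⟨ solve 3 (λ g i l → lit 2 :* g :* (i :* l) := lit 2 :* i :* l :* g) refl (sumOver S good) (m ⁻¹) (ln y) ⟩
          L * sumOver S good
            ≈⟨ *-distribˡ-sum L h ⟩
          sum (λ e → L * h e) ∎

        avoids : ∀ F⁰ → ¬ Hit F⁰ → ∀ e → 1# ≤ pivot-avoided e (lookup F⁰ e)
        avoids F⁰ miss e = by-cases (lookup F⁰ e) (lookup S e) ≡.refl ≡.refl
          where
          1≤1-0 : 1# ≤ 1# - 0#
          1≤1-0 = ≤-reflexive (solve 0 (lit 1 := lit 1 :- lit 0) refl)
          by-cases : ∀ c b → lookup F⁰ e ≡ c → lookup S e ≡ b → 1# ≤ 1# - restrict c (restrict b (good e))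
          by-cases false _     _    _   = 1≤1-0
          by-cases true  false _    _   = 1≤1-0
          by-cases true  true  e∈F⁰ e∈S with goodPivot? e
          ... | yes good = contradiction (e , e∈F⁰ , e∈S , good) miss
          ... | no _     = 1≤1-0

      -- By independence a miss has probability at most the product of the `1 - p⁰ h e`, hence at
      -- most `exp (- L ∑ h)`. With at least `m/2` good pivots and `L = 2 ln y / m`, this is at most
      -- `1/y`.
      miss-probability : y * 𝔼 (randomSubset S (const p⁰)) (λ F⁰ → 𝟙 (¬? (hit? F⁰))) ≤ 1#
      miss-probability = begin
        y * 𝔼 (randomSubset S (const p⁰)) (λ F⁰ → 𝟙 (¬? (hit? F⁰)))
          ≈⟨ *-congˡ (*-identityˡ _) ⟨
        y * (1# * 𝔼 (randomSubset S (const p⁰)) (λ F⁰ → 𝟙 (¬? (hit? F⁰))))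
          ≤⟨ *-monoʳ-≤ (≤-trans 0≤1 1≤y) (markov (λ F⁰ → ¬? (hit? F⁰)) pivot-avoided 1# 0≤1
               (Supported-inclusion S (const p⁰) (λ _ → 0≤p⁰) (λ _ → p⁰≤1))
               pivot-avoided-nonNeg (λ F⁰ _ miss → 1≤product (avoids F⁰ miss))) ⟩
        y * product (λ e → 𝔼 (inclusion S (const p⁰) e) (pivot-avoided e))
          ≈⟨ trans (*-comm _ _) (*-congʳ (product-cong 𝔼-pivot-avoided)) ⟩
        product 1-p⁰h * y
          ≤⟨ *exp≤1⇒*≤1 (product-nonNeg 1-p⁰h-nonNeg) 1≤y (product-*exp 1-p⁰h-nonNeg [1-p⁰h]*exp≤1) ln≤∑Lh ⟩
        1# ∎
        where
        pivot-avoided-nonNeg : ∀ e c → 0# ≤ pivot-avoided e c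
        pivot-avoided-nonNeg e true  = 0≤y-x (proj₂ (0≤h≤1 e))
        pivot-avoided-nonNeg e false = 0≤y-x 0≤1

    Sample : Set c
    Sample = Subset n × (Fin n → ℝ)

    Accurate : ℝ → Pred Sample ℓ
    Accurate ε (F , p) = ∀ v → ∣ sumOver F (λ e → dist v e / p e) - W v ∣ᵣ ≤ ε * W v

    accurate? : ∀ ε → Decidable (Accurate ε)
    accurate? ε (F , p) = Fin.all? λ v → ∣ sumOver F (λ e → dist v e / p e) - W v ∣ᵣ ≤? ε * W v

    module _ {y y′ T ε} (1≤y : 1# ≤ y) (0<T : 0# < T) (0<ε : 0# < ε) (ε≤1 : ε ≤ 1#)
      (1≤y′ : 1# ≤ y′) (y′≈ny : y′ ≈ fromℕ n * y) (72ln≤ε²T : fromℕ 72 * ln y′ ≤ ε * ε * T)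
      where

      probabilities : Subset n → Fin n → ℝ
      probabilities F⁰ e = 1# ⊓ (T * γ F⁰ e)

      private
        N p⁰ : ℝ
        N = fromℕ n
        p⁰ = 1# ⊓ (fromℕ 2 / m * ln y)

        Ŵ : (Fin n → ℝ) → Subset n → Fin n → ℝ
        Ŵ p F v = sumOver F (λ e → dist v e / p e)

        0<p : ∀ F⁰ e → 0# < probabilities F⁰ e
        0<p F⁰ e with ⊓-sel 1# (T * γ F⁰ e)
        ... | inj₁ p≈1  = <-≤-trans 0<1 (≤-reflexive˘ p≈1)
        ... | inj₂ p≈Tγ = <-≤-trans (*-pos 0<T (γ-pos F⁰ e)) (≤-reflexive˘ p≈Tγ)

        p≤1 : ∀ F⁰ e → probabilities F⁰ e ≤ 1#
        p≤1 F⁰ e = x⊓y≤x 1# (T * γ F⁰ e)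

        balanced : ∀ {F⁰} → Hit F⁰ → ∀ v e → lookup S e ≡ true →
          probabilities F⁰ e ≈ 1# ⊎ T * dist v e ≤ fromℕ 9 * W v * probabilities F⁰ e
        balanced {F⁰} hit v e e∈S with ⊓-sel 1# (T * γ F⁰ e)
        ... | inj₁ p≈1  = inj₁ p≈1
        ... | inj₂ p≈Tγ = inj₂ (begin
          T * dist v e                          ≤⟨ *-monoʳ-≤ (proj₁ 0<T) (dist≤9γW {F⁰} hit v e e∈S) ⟩
          T * (fromℕ 9 * (γ F⁰ e * W v))        ≈⟨ solve 3 (λ T g w → T :* (lit 9 :* (g :* w)) := lit 9 :* w :* (T :* g)) refl T (γ F⁰ e) (W v) ⟩
          fromℕ 9 * W v * (T * γ F⁰ e)          ≈⟨ *-congˡ p≈Tγ ⟨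
          fromℕ 9 * W v * probabilities F⁰ e    ∎)

        inaccuracy : Subset n → ℝ
        inaccuracy F⁰ = 𝔼 (randomSubset S (probabilities F⁰)) (λ F → 𝟙 (¬? (accurate? ε (F , probabilities F⁰))))

        -- Every element of the dataset queries this cluster, so the union bound runs over all `n`
        -- of them, with two tails each.
        inaccuracy-hit : ∀ {F⁰} → Hit F⁰ → y′ * inaccuracy F⁰ ≤ fromℕ 2 * N
        inaccuracy-hit {F⁰} hit = begin
          y′ * inaccuracy F⁰
            ≤⟨ *-monoʳ-≤ (≤-trans 0≤1 1≤y′) (𝔼-mono-≤ (Supported-randomSubset S p (λ e → proj₁ (0<p F⁰ e)) (p≤1 F⁰))
                 (λ F _ → union F)) ⟩
          y′ * 𝔼 μ (λ F → sum (λ v → wrong v F))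
            ≈⟨ trans (*-congˡ (𝔼-sum μ wrong)) (*-distribˡ-sum y′ (λ v → 𝔼 μ (wrong v))) ⟩
          sum (λ v → y′ * 𝔼 μ (wrong v))
            ≤⟨ sum-mono-≤ (λ v → two-sided-tail S p (dist v) ε T y′ (dist-nonNeg v) (0<p F⁰) (p≤1 F⁰)
                 0<T 0<ε ε≤1 1≤y′ 72ln≤ε²T (balanced {F⁰} hit v)) ⟩
          sum {n} (const (fromℕ 2))
            ≈⟨ trans (sum-const n (fromℕ 2)) (*-comm _ _) ⟩
          fromℕ 2 * N ∎
          where
          p : Fin n → ℝ
          p = probabilities F⁰
          μ = randomSubset S p
          right? : ∀ v F → Dec (∣ Ŵ p F v - W v ∣ᵣ ≤ ε * W v)
          right? v F = ∣ Ŵ p F v - W v ∣ᵣ ≤? ε * W v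
          wrong : Fin n → Subset n → ℝ
          wrong v F = 𝟙 (¬? (right? v F))
          wrong-nonNeg : ∀ F v → 0# ≤ wrong v F
          wrong-nonNeg F v = 𝟙-nonNeg (¬? (right? v F))
          union : ∀ F → 𝟙 (¬? (accurate? ε (F , p))) ≤ sum (λ v → wrong v F)
          union F = 𝟙≤ (¬? (accurate? ε (F , p))) (sum-nonNeg (wrong-nonNeg F)) λ inaccurate →
            let v , wrong-v = Fin.¬∀⟶∃¬ n _ (λ v → right? v F) inaccurate
            in ≤-trans (≤-reflexive˘ (𝟙-true (¬? (right? v F)) wrong-v)) (term≤sum (wrong-nonNeg F) v)

        inaccuracy≤1 : ∀ F⁰ → inaccuracy F⁰ ≤ 1#
        inaccuracy≤1 F⁰ = ≤-trans
          (𝔼-mono-≤ (Supported-randomSubset S (probabilities F⁰) (λ e → proj₁ (0<p F⁰ e)) (p≤1 F⁰))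
            (λ F _ → 𝟙≤1 (¬? (accurate? ε (F , probabilities F⁰)))))
          (≤-reflexive (Mass1-randomSubset S (probabilities F⁰)))

        -- After a miss no accuracy is claimed: the trivial bound 1 is charged to the indicator of
        -- the miss, to be averaged over `F⁰`.
        inaccuracy≤ : ∀ F⁰ → y′ * inaccuracy F⁰ ≤ y′ * 𝟙 (¬? (hit? F⁰)) + fromℕ 2 * N
        inaccuracy≤ F⁰ with hit? F⁰
        ... | yes hit = ≤-trans (inaccuracy-hit {F⁰} hit)
          (≤-reflexive (solve 2 (λ z s → z := s :* lit 0 :+ z) refl (fromℕ 2 * N) y′))
        ... | no _    = ≤-trans (*-monoʳ-≤ (≤-trans 0≤1 1≤y′) (inaccuracy≤1 F⁰))
          (slack (*-nonNeg (fromℕ-nonNeg 2) (fromℕ-nonNeg n)) refl)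

      private
        phase-iii : Subset n → Dist Sample
        phase-iii F⁰ = randomSubset S (probabilities F⁰) >>= λ F → return (F , probabilities F⁰)

      -- The branch of `samplePPS` for a large cluster, with `y` for 5k/δ and `T` for the sample
      -- size.
      sampling : Dist Sample
      sampling = randomSubset S (const p⁰) >>= phase-iii

      Mass1-sampling : Mass1 sampling
      Mass1-sampling = Mass1->>= (randomSubset S (const p⁰)) phase-iii (Mass1-randomSubset S (const p⁰)) λ F⁰ →
        Mass1->>= (randomSubset S (probabilities F⁰)) (λ F → return (F , probabilities F⁰))
          (Mass1-randomSubset S (probabilities F⁰)) λ F →
        Mass1-return (F , probabilities F⁰)

      Supported-sampling : Supported (const ⊤) sampling
      Supported-sampling = Supported->>=
        (Supported-randomSubset S (const p⁰) (λ _ → 0≤p⁰ 1≤y) (λ _ → p⁰≤1 1≤y)) λ {F⁰} _ →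
          Supported->>= (Supported-randomSubset S (probabilities F⁰) (λ e → proj₁ (0<p F⁰ e)) (p≤1 F⁰))
            λ _ → Supported-return tt

      -- In 3 = 1 + 2, a missed pivot contributes 1 and the two tails contribute 2. The factor `n`
      -- of the union bound is absorbed by `y′ ≈ n y`, which is why both sides are multiplied by
      -- `N`.
      sampling-inaccuracy : 0# < N → y * 𝔼 sampling (λ s → 𝟙 (¬? (accurate? ε s))) ≤ fromℕ 3
      sampling-inaccuracy 0<N = *-cancelʳ-≤ 0<N (begin
        y * 𝔼 sampling (λ s → 𝟙 (¬? (accurate? ε s))) * N
          ≈⟨ trans (solve 3 (λ y e N → y :* e :* N := N :* y :* e) refl y _ N) (*-congʳ (sym y′≈ny)) ⟩
        y′ * 𝔼 sampling (λ s → 𝟙 (¬? (accurate? ε s)))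
          ≈⟨ *-congˡ (trans (𝔼->>= μ phase-iii inaccurate) (𝔼-cong μ λ F⁰ →
               trans (𝔼->>= (randomSubset S (probabilities F⁰)) (λ F → return (F , probabilities F⁰)) inaccurate)
                 (𝔼-cong (randomSubset S (probabilities F⁰)) λ F → 𝔼-return (F , probabilities F⁰) inaccurate))) ⟩
        y′ * 𝔼 μ inaccuracy
          ≈⟨ 𝔼-* μ inaccuracy y′ ⟨
        𝔼 μ (λ F⁰ → y′ * inaccuracy F⁰)
          ≤⟨ 𝔼-mono-≤ (Supported-randomSubset S (const p⁰) (λ _ → 0≤p⁰ 1≤y) (λ _ → p⁰≤1 1≤y)) (λ F⁰ _ → inaccuracy≤ F⁰) ⟩
        𝔼 μ (λ F⁰ → y′ * 𝟙 (¬? (hit? F⁰)) + fromℕ 2 * N)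
          ≈⟨ trans (𝔼-+ μ _ _) (+-cong (𝔼-* μ _ y′) (𝔼-const μ (Mass1-randomSubset S (const p⁰)) (fromℕ 2 * N))) ⟩
        y′ * 𝔼 μ (λ F⁰ → 𝟙 (¬? (hit? F⁰))) + fromℕ 2 * N
          ≈⟨ +-congʳ (trans (*-congʳ y′≈ny) (*-assoc N y _)) ⟩
        N * (y * 𝔼 μ (λ F⁰ → 𝟙 (¬? (hit? F⁰)))) + fromℕ 2 * N
          ≤⟨ +-monoˡ-≤ (fromℕ 2 * N) (*-monoʳ-≤ (proj₁ 0<N) (miss-probability 1≤y)) ⟩
        N * 1# + fromℕ 2 * N
          ≈⟨ solve 1 (λ N → N :* lit 1 :+ lit 2 :* N := lit 3 :* N) refl N ⟩
        fromℕ 3 * N ∎)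
        where
        μ = randomSubset S (const p⁰)
        inaccurate : Sample → ℝ
        inaccurate s = 𝟙 (¬? (accurate? ε s))

-- Propagation of relative errors to silhouettes and their average.

module Stability {c ℓ} (R : CompleteOrderedField c ℓ) where

  open OrderedField R

  module WithTolerance {ε} (0≤ε : 0# ≤ ε) (ε<1 : ε < 1#) where

    open ≤-Reasoning

    infix 4 _≲_
    -- Two one-sided multiplicative bounds pass through minima, maxima and nonnegative scaling
    -- directly, unlike a bound on the absolute difference.
    record _≲_ (x x̂ : ℝ) : Set (c Level.⊔ ℓ) where
      constructor approx
      field
        0≤x   : 0# ≤ x
        lower : (1# - ε) * x ≤ x̂
        upper : x̂ ≤ (1# + ε) * x

    0<1-ε : 0# < 1# - ε
    0<1-ε = ≰⇒> λ 1-ε≤0 → <⇒≱ ε<1 (slack (0≤y-x 1-ε≤0)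
      (solve 1 (λ ε → ε := lit 1 :+ (lit 0 :- (lit 1 :- ε))) refl ε))

    0≤1+ε : 0# ≤ 1# + ε
    0≤1+ε = +-nonNeg 0≤1 0≤ε

    ≲-fromAbs : ∀ {x x̂} → 0# ≤ x → ∣ x̂ - x ∣ᵣ ≤ ε * x → x ≲ x̂
    ≲-fromAbs {x} {x̂} 0≤x close = approx 0≤x
      (slack (0≤y-x (≤-trans (x≤y⊔x (x̂ - x) (- (x̂ - x))) close))
        (solve 3 (λ ε x y → y := (lit 1 :- ε) :* x :+ (ε :* x :- :- (y :- x))) refl ε x x̂))
      (slack (0≤y-x (≤-trans (x≤x⊔y (x̂ - x) (- (x̂ - x))) close))
        (solve 3 (λ ε x y → (lit 1 :+ ε) :* x := y :+ (ε :* x :- (y :- x))) refl ε x x̂))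

    ≲-*ʳ : ∀ {x x̂ r} → 0# ≤ r → x ≲ x̂ → x * r ≲ x̂ * r
    ≲-*ʳ 0≤r (approx 0≤x lower upper) = approx (*-nonNeg 0≤x 0≤r)
      (≤-trans (≤-reflexive˘ (*-assoc _ _ _)) (*-monoˡ-≤ 0≤r lower))
      (≤-trans (*-monoˡ-≤ 0≤r upper) (≤-reflexive (*-assoc _ _ _)))

    ≲-⊓ : ∀ {x x̂ y ŷ} → x ≲ x̂ → y ≲ ŷ → x ⊓ y ≲ x̂ ⊓ ŷ
    ≲-⊓ {x} {x̂} {y} {ŷ} (approx 0≤x lower upper) (approx 0≤y lower′ upper′) = approx
      (⊓-glb 0≤x 0≤y)
      (⊓-glb (≤-trans (*-monoʳ-≤ (proj₁ 0<1-ε) (x⊓y≤x x y)) lower)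
        (≤-trans (*-monoʳ-≤ (proj₁ 0<1-ε) (x⊓y≤y x y)) lower′))
      (case ⊓-sel x y of λ where
        (inj₁ x⊓y≈x) → ≤-trans (x⊓y≤x x̂ ŷ) (≤-trans upper (≤-reflexive˘ (*-congˡ x⊓y≈x)))
        (inj₂ x⊓y≈y) → ≤-trans (x⊓y≤y x̂ ŷ) (≤-trans upper′ (≤-reflexive˘ (*-congˡ x⊓y≈y))))

    ≲-⊔ : ∀ {x x̂ y ŷ} → x ≲ x̂ → y ≲ ŷ → x ⊔ y ≲ x̂ ⊔ ŷ
    ≲-⊔ {x} {x̂} {y} {ŷ} (approx 0≤x lower upper) (approx 0≤y lower′ upper′) = approx
      (≤-trans 0≤x (x≤x⊔y x y))
      (case ⊔-sel x y of λ where
        (inj₁ x⊔y≈x) → ≤-trans (≤-reflexive (*-congˡ x⊔y≈x)) (≤-trans lower (x≤x⊔y x̂ ŷ))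
        (inj₂ x⊔y≈y) → ≤-trans (≤-reflexive (*-congˡ x⊔y≈y)) (≤-trans lower′ (x≤y⊔x x̂ ŷ)))
      (⊔-lub (≤-trans upper (*-monoʳ-≤ 0≤1+ε (x≤x⊔y x y)))
        (≤-trans upper′ (*-monoʳ-≤ 0≤1+ε (x≤y⊔x x y))))

    ≲-minimum : ∀ {n} {f f̂ : Fin (suc n) → ℝ} → (∀ i → f i ≲ f̂ i) → minimum f ≲ minimum f̂
    ≲-minimum {zero}  f≲f̂ = f≲f̂ zero
    ≲-minimum {suc n} f≲f̂ = ≲-⊓ (f≲f̂ zero) (≲-minimum (f≲f̂ ∘ suc))

    ≲-minOther : ∀ {k} (2≤k : 2 ℕ.≤ k) i {f f̂ : Fin k → ℝ} → (∀ j → f j ≲ f̂ j) →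
      minOther 2≤k i f ≲ minOther 2≤k i f̂
    ≲-minOther (ℕ.s≤s (ℕ.s≤s ℕ.z≤n)) i f≲f̂ = ≲-minimum (f≲f̂ ∘ punchIn i)

    -- The signs of `s` and `z` are unknown; the identity `2 (w - s z) = (1 - s)(w + z) + (1 + s)(w
    -- - z)` settles all cases at once.
    s*z≤w : ∀ {s z w} → s ≤ 1# → - s ≤ 1# → z ≤ w → - z ≤ w → s * z ≤ w
    s*z≤w {s} {z} {w} s≤1 -s≤1 z≤w -z≤w = *-cancelʳ-≤ {fromℕ 2} (fromℕ-pos {2} (ℕ.s≤s ℕ.z≤n)) (slack
      (+-nonNeg (*-nonNeg (0≤y-x s≤1) (0≤y-x -z≤w)) (*-nonNeg (0≤y-x -s≤1) (0≤y-x z≤w)))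
      (solve 3 (λ s z w → w :* lit 2 := s :* z :* lit 2 :+
        ((lit 1 :- s) :* (w :- :- z) :+ (lit 1 :- :- s) :* (w :- z))) refl s z w))

    bound : ℝ
    bound = fromℕ 4 * ε / (1# - ε)

    0≤bound : 0# ≤ bound
    0≤bound = /-nonNeg (*-nonNeg (fromℕ-nonNeg 4) 0≤ε) (proj₁ 0<1-ε)

    module _ {a â b b̂ : ℝ} (a≲â : a ≲ â) (b≲b̂ : b ≲ b̂) where

      private
        open _≲_ a≲â using () renaming (0≤x to 0≤a; lower to a-lower; upper to a-upper)
        open _≲_ b≲b̂ using () renaming (0≤x to 0≤b; lower to b-lower; upper to b-upper)
        m m̂ s ŝ : ℝ
        m = a ⊔ b
        m̂ = â ⊔ b̂
        s = (b - a) / m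
        ŝ = (b̂ - â) / m̂
        open _≲_ (≲-⊔ a≲â b≲b̂) using () renaming (0≤x to 0≤m; lower to m-lower; upper to m-upper)
        a≤m : a ≤ m
        a≤m = x≤x⊔y a b
        b≤m : b ≤ m
        b≤m = x≤y⊔x a b

      module _ (0<m : 0# < m) where

        private
          0<m̂ : 0# < m̂
          0<m̂ = <-≤-trans (*-pos 0<1-ε 0<m) m-lower
          s*m≈b-a : s * m ≈ b - a
          s*m≈b-a = /-*-cancel (b - a) (<⇒≉0 0<m)
          s≤1 : s ≤ 1#
          s≤1 = x≤y*z⇒x/z≤y 0<m (slack (+-nonNeg (0≤y-x b≤m) 0≤a)
            (solve 3 (λ a b m → lit 1 :* m := b :- a :+ (m :- b :+ a)) refl a b m))
          -s≤1 : - s ≤ 1#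
          -s≤1 = *-cancelʳ-≤ 0<m (begin
            - s * m     ≈⟨ solve 2 (λ s m → (:- s) :* m := :- (s :* m)) refl s m ⟩
            - (s * m)   ≈⟨ -‿cong s*m≈b-a ⟩
            - (b - a)   ≤⟨ slack (+-nonNeg (0≤y-x a≤m) 0≤b)
                             (solve 3 (λ a b m → lit 1 :* m := :- (b :- a) :+ (m :- a :+ b)) refl a b m) ⟩
            1# * m      ∎)
          m̂-m≤εm : m̂ - m ≤ ε * m
          m̂-m≤εm = slack (0≤y-x m-upper)
            (solve 3 (λ ε m n → ε :* m := n :- m :+ ((lit 1 :+ ε) :* m :- n)) refl ε m m̂)
          m-m̂≤εm : - (m̂ - m) ≤ ε * m
          m-m̂≤εm = slack (0≤y-x m-lower)
            (solve 3 (λ ε m n → ε :* m := :- (n :- m) :+ (n :- (lit 1 :- ε) :* m)) refl ε m m̂)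
          -- The denominator `1 - ε` of the bound comes from here: `m̂` may be as small as
          -- `(1 - ε) m`.
          4εm≤bound*m̂ : fromℕ 4 * ε * m ≤ bound * m̂
          4εm≤bound*m̂ = begin
            fromℕ 4 * ε * m           ≈⟨ *-congʳ (/-*-cancel (fromℕ 4 * ε) (<⇒≉0 0<1-ε)) ⟨
            bound * (1# - ε) * m      ≈⟨ *-assoc _ _ _ ⟩
            bound * ((1# - ε) * m)    ≤⟨ *-monoʳ-≤ 0≤bound m-lower ⟩
            bound * m̂                 ∎
          0≤εm-εa : 0# ≤ ε * m - ε * a
          0≤εm-εa = 0≤y-x (*-monoʳ-≤ 0≤ε a≤m)
          0≤εm-εb : 0# ≤ ε * m - ε * b
          0≤εm-εb = 0≤y-x (*-monoʳ-≤ 0≤ε b≤m)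
          0≤εm : 0# ≤ ε * m
          0≤εm = *-nonNeg 0≤ε 0≤m

          -- After clearing `m̂`, the numerator moves by at most `ε (a + b) ≤ 2εm`, and replacing
          -- `s * m` by `s * m̂` costs one more `εm` because `s` lies between -1 and 1.
          ŝ≤s+bound : ŝ ≤ s + bound
          ŝ≤s+bound = x≤y*z⇒x/z≤y 0<m̂ (begin
            b̂ - â
              ≤⟨ slack (+-nonNeg (+-nonNeg (0≤y-x b-upper) (0≤y-x a-lower)) (+-nonNeg 0≤εm-εa 0≤εm-εb))
                   (solve 6 (λ a b â b̂ m ε → b :- a :+ lit 2 :* (ε :* m) := b̂ :- â :+
                     (((lit 1 :+ ε) :* b :- b̂) :+ (â :- (lit 1 :- ε) :* a) :+ ((ε :* m :- ε :* a) :+ (ε :* m :- ε :* b))))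
                     refl a b â b̂ m ε) ⟩
            b - a + fromℕ 2 * (ε * m)
              ≈⟨ +-congʳ s*m≈b-a ⟨
            s * m + fromℕ 2 * (ε * m)
              ≤⟨ slack (0≤y-x (s*z≤w s≤1 -s≤1 m-m̂≤εm (≤-trans (≤-reflexive (-‿involutive _)) m̂-m≤εm)))
                   (solve 4 (λ s m m̂ ε → s :* m̂ :+ lit 3 :* (ε :* m) := s :* m :+ lit 2 :* (ε :* m) :+
                     (ε :* m :- s :* (:- (m̂ :- m)))) refl s m m̂ ε) ⟩
            s * m̂ + fromℕ 3 * (ε * m)
              ≤⟨ +-monoʳ-≤ (s * m̂) (≤-trans (slack 0≤εm (solve 2 (λ ε m → lit 4 :* ε :* m :=
                   lit 3 :* (ε :* m) :+ ε :* m) refl ε m)) 4εm≤bound*m̂) ⟩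
            s * m̂ + bound * m̂
              ≈⟨ distribʳ m̂ s bound ⟨
            (s + bound) * m̂ ∎)

          s-bound≤ŝ : s - bound ≤ ŝ
          s-bound≤ŝ = y*z≤x⇒y≤x/z 0<m̂ (begin
            (s - bound) * m̂
              ≈⟨ solve 3 (λ s B m̂ → (s :- B) :* m̂ := s :* m̂ :- B :* m̂) refl s bound m̂ ⟩
            s * m̂ - bound * m̂
              ≤⟨ +-monoʳ-≤ (s * m̂) (-‿anti-≤ (≤-trans (slack 0≤εm (solve 2 (λ ε m → lit 4 :* ε :* m :=
                   lit 3 :* (ε :* m) :+ ε :* m) refl ε m)) 4εm≤bound*m̂)) ⟩
            s * m̂ - fromℕ 3 * (ε * m)
              ≤⟨ slack (0≤y-x (s*z≤w s≤1 -s≤1 m̂-m≤εm m-m̂≤εm))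
                   (solve 4 (λ s m m̂ ε → s :* m :- lit 2 :* (ε :* m) := s :* m̂ :- lit 3 :* (ε :* m) :+
                     (ε :* m :- s :* (m̂ :- m))) refl s m m̂ ε) ⟩
            s * m - fromℕ 2 * (ε * m)
              ≈⟨ +-congʳ s*m≈b-a ⟩
            b - a - fromℕ 2 * (ε * m)
              ≤⟨ slack (+-nonNeg (+-nonNeg (0≤y-x b-lower) (0≤y-x a-upper)) (+-nonNeg 0≤εm-εa 0≤εm-εb))
                   (solve 6 (λ a b â b̂ m ε → b̂ :- â := b :- a :- lit 2 :* (ε :* m) :+
                     ((b̂ :- (lit 1 :- ε) :* b) :+ ((lit 1 :+ ε) :* a :- â) :+ ((ε :* m :- ε :* a) :+ (ε :* m :- ε :* b))))
                     refl a b â b̂ m ε) ⟩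
            b̂ - â ∎)

        ratio-stable-pos : ∣ ŝ - s ∣ᵣ ≤ bound
        ratio-stable-pos = ∣x∣≤y
          (slack (0≤y-x ŝ≤s+bound) (solve 3 (λ ŝ s B → B := ŝ :- s :+ (s :+ B :- ŝ)) refl ŝ s bound))
          (slack (0≤y-x s-bound≤ŝ) (solve 3 (λ ŝ s B → B := :- (ŝ :- s) :+ (ŝ :- (s :- B))) refl ŝ s bound))

      ratio-stable : ∣ (b̂ - â) / (â ⊔ b̂) - (b - a) / (a ⊔ b) ∣ᵣ ≤ bound
      ratio-stable with m ≤? 0#
      ... | no m≰0  = ratio-stable-pos (≰⇒> m≰0)
      -- A vanishing `m` forces `m̂ ≈ 0#`, so both quotients are 0 by the division convention.
      ... | yes m≤0 = ∣x∣≤y (≤-trans (≤-reflexive D≈0) 0≤bound)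
        (≤-trans (≤-reflexive (trans (-‿cong D≈0) -0#≈0#)) 0≤bound)
        where
        m≈0 : m ≈ 0#
        m≈0 = antisym m≤0 0≤m
        m̂≈0 : m̂ ≈ 0#
        m̂≈0 = antisym
          (≤-trans m-upper (≤-reflexive (trans (*-congˡ m≈0) (zeroʳ _))))
          (≤-trans (*-nonNeg (proj₁ 0<1-ε) 0≤m) m-lower)
        D≈0 : ŝ - s ≈ 0#
        D≈0 = trans (+-cong (trans (*-congˡ (x≈0⇒x⁻¹≈0 m̂≈0)) (zeroʳ _))
          (-‿cong (trans (*-congˡ (x≈0⇒x⁻¹≈0 m≈0)) (zeroʳ _)))) (-‿inverseʳ 0#)

    average-stable : ∀ {n} {f f̂ : Fin n → ℝ} → 0 ℕ.< n → (∀ i → ∣ f̂ i - f i ∣ᵣ ≤ bound) →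
      ∣ average f̂ - average f ∣ᵣ ≤ bound
    average-stable {n} {f} {f̂} 0<n close = ∣x∣≤y
      (slack (0≤y-x (mean f̂ f λ i → ≤-trans (x≤x⊔y (f̂ i - f i) (- (f̂ i - f i))) (close i)))
        (solve 3 (λ x y B → B := y :- x :+ (x :+ B :- y)) refl (average f) (average f̂) bound))
      (slack (0≤y-x (mean f f̂ λ i → ≤-trans (≤-reflexive (solve 2 (λ x y → x :- y := :- (y :- x)) refl (f i) (f̂ i)))
          (≤-trans (x≤y⊔x (f̂ i - f i) (- (f̂ i - f i))) (close i))))
        (solve 3 (λ x y B → B := :- (y :- x) :+ (y :+ B :- x)) refl (average f) (average f̂) bound))
      where
      N : ℝ
      N = fromℕ n
      0<N : 0# < N
      0<N = fromℕ-pos 0<n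
      mean : ∀ f g → (∀ i → f i - g i ≤ bound) → average f ≤ average g + bound
      mean f g f-g≤bound = begin
        1# / N * sum f
          ≤⟨ *-monoʳ-≤ (/-nonNeg 0≤1 (proj₁ 0<N)) (sum-mono-≤ λ i → slack (0≤y-x (f-g≤bound i))
               (solve 3 (λ x y B → y :+ B := x :+ (B :- (x :- y))) refl (f i) (g i) bound)) ⟩
        1# / N * sum (λ i → g i + bound)
          ≈⟨ *-congˡ (trans (∑-distrib-+ g (const bound)) (+-congˡ (sum-const n bound))) ⟩
        1# / N * (sum g + N * bound)
          ≈⟨ solve 4 (λ i S N B → i :* (S :+ N :* B) := i :* S :+ i :* N :* B) refl (1# / N) (sum g) N bound ⟩
        1# / N * sum g + 1# / N * N * bound
          ≈⟨ +-congˡ (trans (*-congʳ (/-*-cancel 1# (<⇒≉0 0<N))) (*-identityˡ bound)) ⟩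
        average g + bound ∎

-- The estimator on the whole clustering, and the union bound over clusters.

module Estimation
  {c ℓ u ℓᵤ : Level} {R : CompleteOrderedField c ℓ} {M : MetricSpace R u ℓᵤ}
  {n k : ℕ} (V : Dataset M n) (𝒞 : Clustering n k)
  where

  open OrderedField R

  module _ {ε δ : ℝ} (0<ε : 0# < ε) (ε<1 : ε < 1#) (0<δ : 0# < δ) (δ<1 : δ < 1#)
    {t : ℕ} (t-large : fromℕ 72 / ε ^ 2 * ln (fromℕ (5 ℕ.* n ℕ.* k) / δ) ≤ fromℕ t)
    where

    open Exponential R
    open Expectation R
    open SumOver R
    open Silhouette V 𝒞
    open Clustering 𝒞
    open MetricSpace M using (isGeneralMetric)
    open ClusterSampling R
    open Stability R
    open WithTolerance (proj₁ 0<ε) ε<1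
    open ≤-Reasoning

    open SilhPPSAll δ t

    private
      T y y′ : ℝ
      T  = fromℕ t
      y  = fromℕ (5 ℕ.* k) / δ
      y′ = fromℕ (5 ℕ.* n ℕ.* k) / δ

    0<k : 0 ℕ.< k
    0<k = ℕ.≤-trans (ℕ.s≤s ℕ.z≤n) 2≤k

    0<n : 0 ℕ.< n
    0<n = ℕ.>-nonZero⁻¹ n {{Fin.nonZeroIndex (proj₁ (nonempty (fromℕ< 0<k)))}}

    private
      1<x/δ : ∀ {x} → 1# ≤ x → 1# < x / δ
      1<x/δ {x} 1≤x = ≰⇒> λ x/δ≤1 → <⇒≱ δ<1 (begin
        1#         ≤⟨ 1≤x ⟩
        x          ≈⟨ /-*-cancel x (<⇒≉0 0<δ) ⟨
        x / δ * δ  ≤⟨ *-monoˡ-≤ (proj₁ 0<δ) x/δ≤1 ⟩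
        1# * δ     ≈⟨ *-identityˡ δ ⟩
        δ          ∎)

      1≤fromℕ : ∀ {m} → 0 ℕ.< m → 1# ≤ fromℕ m
      1≤fromℕ {suc m} _ = 1≤fromℕ-suc m

      1≤y : 1# ≤ y
      1≤y = proj₁ (1<x/δ (1≤fromℕ (ℕ.*-mono-< {0} {5} (ℕ.s≤s ℕ.z≤n) 0<k)))

      1<y′ : 1# < y′
      1<y′ = 1<x/δ (1≤fromℕ (ℕ.*-mono-< (ℕ.*-mono-< {0} {5} (ℕ.s≤s ℕ.z≤n) 0<n) 0<k))

      yδ≈5k : y * δ ≈ fromℕ 5 * fromℕ k
      yδ≈5k = trans (/-*-cancel _ (<⇒≉0 0<δ)) (fromℕ-* 5 k)

      y′≈ny : y′ ≈ fromℕ n * y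
      y′≈ny = *-cancelʳ-≈ 0<δ (begin-equality
        y′ * δ                          ≈⟨ /-*-cancel _ (<⇒≉0 0<δ) ⟩
        fromℕ (5 ℕ.* n ℕ.* k)           ≈⟨ trans (fromℕ-* (5 ℕ.* n) k) (*-congʳ (fromℕ-* 5 n)) ⟩
        fromℕ 5 * fromℕ n * fromℕ k     ≈⟨ solve 3 (λ f n k → f :* n :* k := n :* (f :* k)) refl (fromℕ 5) (fromℕ n) (fromℕ k) ⟩
        fromℕ n * (fromℕ 5 * fromℕ k)   ≈⟨ *-congˡ yδ≈5k ⟨
        fromℕ n * (y * δ)               ≈⟨ *-assoc _ _ _ ⟨
        fromℕ n * y * δ                 ∎)

      0<ε² : 0# < ε ^ 2
      0<ε² = *-pos 0<ε (*-pos 0<ε 0<1)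

      72ln≤ε²T : fromℕ 72 * ln y′ ≤ ε * ε * T
      72ln≤ε²T = begin
        fromℕ 72 * ln y′                       ≈⟨ *-congʳ (/-*-cancel (fromℕ 72) (<⇒≉0 0<ε²)) ⟨
        fromℕ 72 / ε ^ 2 * ε ^ 2 * ln y′       ≈⟨ solve 3 (λ z e l → z :* e :* l := z :* l :* e) refl (fromℕ 72 / ε ^ 2) (ε ^ 2) (ln y′) ⟩
        fromℕ 72 / ε ^ 2 * ln y′ * ε ^ 2       ≤⟨ *-monoˡ-≤ (proj₁ 0<ε²) t-large ⟩
        T * ε ^ 2                              ≈⟨ solve 2 (λ T ε → T :* (ε :* (ε :* lit 1)) := ε :* ε :* T) refl T ε ⟩
        ε * ε * T                              ∎

      -- Otherwise `ln y′ ≤ 0`, and the trivial instance `1 · e⁰ ≤ 1` would give `y′ ≤ 1`; but `y′`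
      -- exceeds 1 because `δ < 1`.
      0<T : 0# < T
      0<T = ≰⇒> λ T≤0 → <⇒≱ 1<y′ (≤-trans (≤-reflexive˘ (*-identityˡ y′))
        (*exp≤1⇒*≤1 0≤1 (proj₁ 1<y′) 1*exp0≤1 (*-cancelʳ-≤ {fromℕ 72} (fromℕ-pos {72} (ℕ.s≤s ℕ.z≤n)) (begin
          ln y′ * fromℕ 72     ≈⟨ *-comm _ _ ⟩
          fromℕ 72 * ln y′     ≤⟨ 72ln≤ε²T ⟩
          ε * ε * T            ≤⟨ *-monoʳ-≤ (square-nonNeg ε) T≤0 ⟩
          ε * ε * 0#           ≈⟨ solve 1 (λ e → e :* lit 0 := lit 0 :* lit 72) refl (ε * ε) ⟩
          0# * fromℕ 72        ∎))))

    0<size : ∀ j → 0 ℕ.< size j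
    0<size j with nonempty j
    ... | e , e↦j = pos (size j) (≤-trans (term≤sumOver (members j) (λ _ → 0≤1) e e∈j)
          (≤-reflexive˘ (∣S∣≈sumOver-1 (members j))))
      where
      e∈j : lookup (members j) e ≡ true
      e∈j = ≡.trans (lookup∘tabulate (λ e → does (cluster e Fin.≟ j)) e)
        (dec-true (cluster e Fin.≟ j) (e↦j ≡.refl))
      pos : ∀ s → 1# ≤ fromℕ s → 0 ℕ.< s
      pos zero    1≤0 = contradiction 1≤0 (<⇒≱ 0<1)
      pos (suc s) _   = ℕ.s≤s ℕ.z≤n

    private
      module Metric = IsGeneralMetric isGeneralMetric

    module Cluster (j : Fin k) = FromSubset (members j) dist (λ _ _ → Metric.nonNegative)
      (λ _ _ → Metric.sym _ _) (λ _ _ _ → Metric.triangle _ _ _) (0<size j)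

    Accurate : Vec Sample k → Set _
    Accurate samples = ∀ j → Cluster.Accurate j ε (lookup samples j)

    silhouette-accurate : ∀ samples → Accurate samples →
      ∣ average (From.s (Ŵ samples)) - silhouette ∣ᵣ ≤ bound
    silhouette-accurate samples accurate = average-stable 0<n s-accurate
      where
      W-accurate : ∀ j e → W j e ≲ Ŵ samples j e
      W-accurate j e = ≲-fromAbs (Cluster.W-nonNeg j e) (accurate j e)
      0≤size-1 : ∀ j → 0# ≤ fromℕ (size j) - 1#
      0≤size-1 j = 0≤y-x (1≤fromℕ (0<size j))
      s-accurate : ∀ e → ∣ From.s (Ŵ samples) e - From.s W e ∣ᵣ ≤ bound
      -- In a singleton cluster the divisor `size - 1` is 0, which the scaling lemma admits; both
      -- silhouettes are then set to 0 by the conditional.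
      s-accurate e = unless (does (size (cluster e) ℕ.≟ 1)) (ratio-stable
        (≲-*ʳ (⁻¹-nonNeg (0≤size-1 (cluster e))) (W-accurate (cluster e) e))
        (≲-minOther 2≤k (cluster e) λ j → ≲-*ʳ (⁻¹-nonNeg (fromℕ-nonNeg (size j))) (W-accurate j e)))
        where
        unless : ∀ singleton {x x̂} → ∣ x̂ - x ∣ᵣ ≤ bound →
          ∣ (if singleton then 0# else x̂) - (if singleton then 0# else x) ∣ᵣ ≤ bound
        unless false close = close
        unless true  _     = ∣x∣≤y (≤-trans (≤-reflexive (-‿inverseʳ 0#)) 0≤bound)
          (≤-trans (≤-reflexive (trans (-‿cong (-‿inverseʳ 0#)) -0#≈0#)) 0≤bound)

    inaccurate : Fin k → Sample → ℝ
    inaccurate j s = 𝟙 (¬? (Cluster.accurate? j ε s))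

    inaccurate-nonNeg : ∀ j s → 0# ≤ inaccurate j s
    inaccurate-nonNeg j s = 𝟙-nonNeg (¬? (Cluster.accurate? j ε s))

    private
      sampling : Fin k → Dist Sample
      sampling j = Cluster.sampling j 1≤y 0<T 0<ε (proj₁ ε<1) (proj₁ 1<y′) y′≈ny 72ln≤ε²T

      exhaustive : Fin k → Sample
      exhaustive j = members j , const 1#

      -- The case split on whether the cluster has at most `t` elements, shared by mass, support and
      -- accuracy.
      samplePPS-elim : ∀ {p} (P : Dist Sample → Set p) j →
        P (return (exhaustive j)) → P (sampling j) → P (samplePPS j)
      samplePPS-elim P j = branch (does (size j ℕ.≤? t))
        where
        branch : ∀ b {μ ν} → P μ → P ν → P (if b then μ else ν)
        branch true  Pμ _  = Pμ
        branch false _  Pν = Pν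

    Mass1-samplePPS : ∀ j → Mass1 (samplePPS j)
    Mass1-samplePPS j = samplePPS-elim Mass1 j (Mass1-return (exhaustive j))
      (Cluster.Mass1-sampling j 1≤y 0<T 0<ε (proj₁ ε<1) (proj₁ 1<y′) y′≈ny 72ln≤ε²T)

    Supported-samplePPS : ∀ j → Supported (const ⊤) (samplePPS j)
    Supported-samplePPS j = samplePPS-elim (Supported (const ⊤)) j (Supported-return {x = exhaustive j} tt)
      (Cluster.Supported-sampling j 1≤y 0<T 0<ε (proj₁ ε<1) (proj₁ 1<y′) y′≈ny 72ln≤ε²T)

    samplePPS-inaccuracy : ∀ j → y * 𝔼 (samplePPS j) (inaccurate j) ≤ fromℕ 3
    samplePPS-inaccuracy j = samplePPS-elim (λ μ → y * 𝔼 μ (inaccurate j) ≤ fromℕ 3) j (begin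
        y * 𝔼 (return (exhaustive j)) (inaccurate j)
          ≈⟨ *-congˡ (trans (𝔼-return (exhaustive j) (inaccurate j))
               (𝟙-false (¬? (Cluster.accurate? j ε (exhaustive j))) (λ ¬exact → ¬exact exact))) ⟩
        y * 0#
          ≈⟨ zeroʳ y ⟩
        0#
          ≤⟨ fromℕ-nonNeg 3 ⟩
        fromℕ 3 ∎)
      (Cluster.sampling-inaccuracy j 1≤y 0<T 0<ε (proj₁ ε<1) (proj₁ 1<y′) y′≈ny 72ln≤ε²T (fromℕ-pos 0<n))
      where
      exact : Cluster.Accurate j ε (exhaustive j)
      exact v = ≤-trans (∣x∣≤y (≤-reflexive D≈0) (≤-reflexive (trans (-‿cong D≈0) -0#≈0#)))
        (*-nonNeg (proj₁ 0<ε) (Cluster.W-nonNeg j v))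
        where
        D≈0 : sumOver (members j) (λ e → dist v e / 1#) - W j v ≈ 0#
        D≈0 = trans (+-congʳ (sumOver-cong (members j) λ e _ →
          trans (*-congˡ (x≈1⇒x⁻¹≈1 refl)) (*-identityʳ _))) (-‿inverseʳ (W j v))

    private
      failure : ℝ
      failure = sum (λ j → 𝔼 (samplePPS j) (inaccurate j))

    -- Each of the `k` clusters contributes at most `3/y`, and `y δ = 5k`.
    failure≤δ : failure ≤ δ
    failure≤δ = *-cancelʳ-≤ (*-pos (fromℕ-pos {5} (ℕ.s≤s ℕ.z≤n)) (fromℕ-pos 0<k)) (begin
      failure * (fromℕ 5 * fromℕ k)
        ≈⟨ *-congˡ yδ≈5k ⟨
      failure * (y * δ)
        ≈⟨ solve 3 (λ f y d → f :* (y :* d) := y :* f :* d) refl failure y δ ⟩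
      y * failure * δ
        ≈⟨ *-congʳ (*-distribˡ-sum y (λ j → 𝔼 (samplePPS j) (inaccurate j))) ⟩
      sum (λ j → y * 𝔼 (samplePPS j) (inaccurate j)) * δ
        ≤⟨ *-monoˡ-≤ (proj₁ 0<δ) (≤-trans (sum-mono-≤ samplePPS-inaccuracy) (≤-reflexive (sum-const k (fromℕ 3)))) ⟩
      fromℕ k * fromℕ 3 * δ
        ≤⟨ slack (*-nonNeg (*-nonNeg (fromℕ-nonNeg k) (fromℕ-nonNeg 2)) (proj₁ 0<δ))
             (solve 2 (λ k d → d :* (lit 5 :* k) := k :* lit 3 :* d :+ k :* lit 2 :* d) refl (fromℕ k) δ) ⟩
      δ * (fromℕ 5 * fromℕ k) ∎)

    -- The union bound over clusters is made pointwise: 1 minus the number of inaccurate clusters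
    -- never exceeds the indicator of success. Taking expectations, each inaccuracy depends on one
    -- coordinate only and reduces to its marginal.
    estimates-accurate : 1# - δ ≤ Pr estimates (λ ŝ → ∣ average ŝ - silhouette ∣ᵣ ≤? bound)
    estimates-accurate = begin
      1# - δ
        ≤⟨ +-monoʳ-≤ 1# (-‿anti-≤ failure≤δ) ⟩
      1# - failure
        ≈⟨ +-cong (Mass1-independently samplePPS Mass1-samplePPS) (-‿cong
             (trans (𝔼-sum μ (λ j samples → inaccurate j (lookup samples j)))
               (sum-cong-≋ λ j → 𝔼-lookup samplePPS Mass1-samplePPS j (inaccurate j)))) ⟨
      𝔼 μ (const 1#) - 𝔼 μ failures
        ≈⟨ trans (𝔼-+ μ (const 1#) (λ samples → - 1# * failures samples)) (+-congˡ
             (trans (𝔼-* μ failures (- 1#)) (solve 1 (λ x → (:- lit 1) :* x := :- x) refl (𝔼 μ failures)))) ⟨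
      𝔼 μ (λ samples → 1# + - 1# * failures samples)
        ≤⟨ 𝔼-mono-≤ (Supported-independently Supported-samplePPS) (λ samples _ → pointwise samples) ⟩
      𝔼 μ (λ samples → 𝟙 (close? (From.s (Ŵ samples))))
        ≈⟨ trans (𝔼->>= μ (λ samples → return (From.s (Ŵ samples))) (𝟙 ∘ close?))
             (𝔼-cong μ λ samples → 𝔼-return (From.s (Ŵ samples)) (𝟙 ∘ close?)) ⟨
      𝔼 estimates (𝟙 ∘ close?)
        ≈⟨ Pr≈𝔼 estimates close? ⟨
      Pr estimates close? ∎
      where
      μ = independently samplePPS
      close? : ∀ ŝ → Dec (∣ average ŝ - silhouette ∣ᵣ ≤ bound)
      close? ŝ = ∣ average ŝ - silhouette ∣ᵣ ≤? bound
      failures : Vec Sample k → ℝ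
      failures samples = sum (λ j → inaccurate j (lookup samples j))
      pointwise : ∀ samples → 1# + - 1# * failures samples ≤ 𝟙 (close? (From.s (Ŵ samples)))
      pointwise samples with Fin.all? (λ j → Cluster.accurate? j ε (lookup samples j))
      ... | yes accurate = ≤-trans
        (slack (sum-nonNeg λ j → inaccurate-nonNeg j (lookup samples j))
          (solve 1 (λ f → lit 1 := lit 1 :+ (:- lit 1) :* f :+ f) refl (failures samples)))
        (≤-reflexive˘ (𝟙-true (close? (From.s (Ŵ samples))) (silhouette-accurate samples accurate)))
      ... | no ¬accurate with Fin.¬∀⟶∃¬ k _ (λ j → Cluster.accurate? j ε (lookup samples j)) ¬accurate
      ...   | j , wrong = ≤-trans
        (slack (0≤y-x (≤-trans
            (≤-reflexive˘ (𝟙-true (¬? (Cluster.accurate? j ε (lookup samples j))) wrong))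
            (term≤sum (λ j → inaccurate-nonNeg j (lookup samples j)) j)))
          (solve 1 (λ f → lit 0 := lit 1 :+ (:- lit 1) :* f :+ (f :- lit 1)) refl (failures samples)))
        (𝟙-nonNeg (close? (From.s (Ŵ samples))))

theorem4 : {c ℓ u ℓᵤ : Level} (R : CompleteOrderedField c ℓ) →
    let open RealArithmetic R
        open Probability R
    in
    ∃ λ (K : ℝ) → 0# < K ×
    ({n k : ℕ} (M : MetricSpace R u ℓᵤ) (V : Dataset M n) (𝒞 : Clustering n k)
     (ε δ : ℝ) → 0# < ε → ε < 1# → 0# < δ → δ < 1# →
     let open Silhouette V 𝒞
         t = ⌈ (K / ε ^ 2) * ln (fromℕ (5 ℕ.* n ℕ.* k) / δ) ⌉
     in
     1# - δ ≤ Pr (SilhPPSAll.estimates δ t)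
       (λ ŝ → ∣ average ŝ - silhouette ∣ᵣ ≤? fromℕ 4 * ε / (1# - ε)))
theorem4 R = fromℕ 72 , fromℕ-pos {72} (ℕ.s≤s ℕ.z≤n) , λ M V 𝒞 ε δ 0<ε ε<1 0<δ δ<1 →
  Estimation.estimates-accurate V 𝒞 0<ε ε<1 0<δ δ<1 (x≤⌈x⌉ _)
  where
  open OrderedField R
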